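{- Let $\tau$ be an arithmetic signature. Then for every $\tau$-formula $\phi$ in negation normal form there is a $\tau$-formula $\phi'$ such that (1) $\phi'$ is equivalent to $\phi$ on finite structures (i.e. on all structures in $\mathrm{STRUC}[\tau]$ and all assignments to the free variables), (2) $\mathrm{qr}(\phi') = 3\cdot \mathrm{strong\text{ - }qr}(\phi) + O(\mathrm{arity}(\tau))$, and (3) $|\mathrm{bound}(\phi')| = |\mathrm{strong\text{ - }bound}(\phi)| + O(\mathrm{arity}(\tau))$.
   Context: A signature $\tau$ is arithmetic if it contains $<$, ternary $\mathrm{add}$, ternary $\mathrm{mult}$, unary function $\mathrm{succ}$ and constant $0$; $\mathrm{STRUC}[\tau]$ contains only finite $\tau$-structures in which $<$ is a linear order and $\mathrm{add},\mathrm{mult},\mathrm{succ},0$ have their natural meaning relative to it. $\mathrm{arity}(\tau)$ is the maximum arity of a relation symbol in $\tau$. A formula is in negation normal form if negations are applied only to atoms; $x \neq y$ abbreviates $\neg\, x=y$. For a subformula of the form $\forall d(\psi)$ or $\exists d(\psi)$, the variable $d$ is said to depend on all variables free in $\psi$. The leading quantifier of a (sub)formula $\exists x(\psi)$ in negation normal form is strong if (i) some universal quantifier binding inside $\psi$ depends on $x$, or (ii) there is a subformula $\alpha \land \beta$ of $\psi$ such that both $\alpha$ and $\beta$ contain $x$ in literals that are not of the form $x \neq y$ for some variable $y$; otherwise the quantifier is weak. (Universal quantifiers are always strong here.) $\mathrm{qr}$ is quantifier rank; $\mathrm{bound}(\phi)$ is the set of bound variables; $\mathrm{strong\text{ - }qr}(\phi)$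 is the quantifier rank of $\phi$ when weak quantifiers are ignored (not counted); $\mathrm{strong\text{ - }bound}(\phi)$ is the set of variables of $\phi$ bound by non-weak quantifiers. $O(\mathrm{arity}(\tau))$ denotes a quantity bounded by $c\cdot\mathrm{arity}(\tau)+c$ for an absolute constant $c$.
   Formalization: Function symbols of the signature are restricted to unary ones and constants; with a function symbol of arity at least 2 the claim fails, since nested terms express k-clique in a single atom with only weak quantifiers. -}

module Defs where

open import Data.Bool using (Bool; T; if_then_else_)
open import Data.Bool.Properties using (T?)
open import Data.Empty using (⊥)
open import Data.Fin using (Fin)
open import Data.List using (List; []; _∷_; _++_; filter; length; deduplicate; allFin)
open import Data.List.Extrema.Nat using (max)
open import Data.List.Membership.Propositional using (_∈_)
open import Data.List.Membership.DecPropositional using () renaming (_∈?_ to member?)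
open import Data.List.Relation.Unary.Any using (Any; any?)
open import Data.Nat using (ℕ; suc; _+_; _*_; _⊔_; _≟_)
open import Data.Product using (Σ-syntax; _×_)
open import Data.Sum using (_⊎_)
open import Data.Vec using (Vec; []; _∷_; map)
open import Function.Bundles using (_⇔_)
open import Relation.Binary.PropositionalEquality using (_≡_; _≢_)
open import Relation.Binary.Structures using (IsStrictTotalOrder)
open import Relation.Nullary using (¬_; Dec; no; ⌊_⌋)
open import Relation.Nullary.Decidable using (¬?; _×-dec_; _⊎-dec_)

-- `relations` lists the arities of the relation symbols, and a relation symbol
-- of arity r is a position of r in that list, i.e. an element of r ∈ relations.
-- Function symbols are unary or constants: `arity` below measures relation
-- symbols only, so an atom then contains at most max (arity τ) 2 variables.
record Signature : Set where
  field
    relations : List ℕ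
    functions : ℕ
    constants : ℕ

open Signature public

arity : Signature → ℕ
arity τ = max 0 (relations τ)

record IsArithmetic (τ : Signature) : Set where
  field
    lt       : 2 ∈ relations τ
    add      : 3 ∈ relations τ
    mult     : 3 ∈ relations τ
    add≢mult : add ≢ mult
    succ     : Fin (functions τ)
    zero     : Fin (constants τ)

-- Variables are names, since the number of distinct variables of a formula
-- depends on how names are reused.
Variable : Set
Variable = ℕ

data Term (τ : Signature) : Set where
  var   : Variable → Term τ
  const : Fin (constants τ) → Term τ
  app   : Fin (functions τ) → Term τ → Term τ

infix  8 _≐_
infix  7 ~_
infixr 6 _∧_
infixr 5 _∨_

data Formula (τ : Signature) : Set where
  rel    : ∀ {r} → r ∈ relations τ → Vec (Term τ) r → Formula τ
  _≐_    : Term τ → Term τ → Formula τ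
  ~_     : Formula τ → Formula τ
  _∧_    : Formula τ → Formula τ → Formula τ
  _∨_    : Formula τ → Formula τ → Formula τ
  forAll : Variable → Formula τ → Formula τ
  exists : Variable → Formula τ → Formula τ

data IsAtom {τ : Signature} : Formula τ → Set where
  rel : ∀ {r} (R : r ∈ relations τ) (ts : Vec (Term τ) r) → IsAtom (rel R ts)
  _≐_ : ∀ s t → IsAtom (s ≐ t)

data IsNNF {τ : Signature} : Formula τ → Set where
  atom   : ∀ {φ} → IsAtom φ → IsNNF φ
  ~_     : ∀ {φ} → IsAtom φ → IsNNF (~ φ)
  _∧_    : ∀ {φ ψ} → IsNNF φ → IsNNF ψ → IsNNF (φ ∧ ψ)
  _∨_    : ∀ {φ ψ} → IsNNF φ → IsNNF ψ → IsNNF (φ ∨ ψ)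
  forAll : ∀ {φ} x → IsNNF φ → IsNNF (forAll x φ)
  exists : ∀ {φ} x → IsNNF φ → IsNNF (exists x φ)

record Structure (τ : Signature) : Set where
  field
    size : ℕ

  Universe : Set
  Universe = Fin size

  field
    ⟦_⟧ʳ : ∀ {r} → r ∈ relations τ → Vec Universe r → Bool
    ⟦_⟧ᶠ : Fin (functions τ) → Universe → Universe
    ⟦_⟧ᶜ : Fin (constants τ) → Universe

module _ {τ : Signature} (ar : IsArithmetic τ) (S : Structure τ) where
  open IsArithmetic ar
  open Structure S

  -- The natural number that an element stands for.
  rank : Universe → ℕ
  rank x = length (filter (λ y → T? (⟦ lt ⟧ʳ (y ∷ x ∷ []))) (allFin size))

  -- Membership in STRUC[τ]. No value is prescribed for the successor of the
  -- maximum, so every convention for it is covered.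
  record IsArithmeticStructure : Set where
    field
      lt-linear    : IsStrictTotalOrder _≡_ (λ x y → T (⟦ lt ⟧ʳ (x ∷ y ∷ [])))
      add-natural  : ∀ x y z →
                     T (⟦ add ⟧ʳ (x ∷ y ∷ z ∷ [])) ⇔ rank x + rank y ≡ rank z
      mult-natural : ∀ x y z →
                     T (⟦ mult ⟧ʳ (x ∷ y ∷ z ∷ [])) ⇔ rank x * rank y ≡ rank z
      succ-natural : ∀ x y → rank y ≡ suc (rank x) → ⟦ succ ⟧ᶠ x ≡ y
      zero-natural : rank ⟦ zero ⟧ᶜ ≡ 0

module Semantics {τ : Signature} (S : Structure τ) where
  open Structure S

  Assignment : Set
  Assignment = Variable → Universe

  _[_↦_] : Assignment → Variable → Universe → Assignment
  (ρ [ x ↦ a ]) y = if ⌊ y ≟ x ⌋ then a else ρ y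

  eval : Assignment → Term τ → Universe
  eval ρ (var x)   = ρ x
  eval ρ (const c) = ⟦ c ⟧ᶜ
  eval ρ (app f t) = ⟦ f ⟧ᶠ (eval ρ t)

  infix 4 _⊨_
  _⊨_ : Assignment → Formula τ → Set
  ρ ⊨ rel R ts   = T (⟦ R ⟧ʳ (map (eval ρ) ts))
  ρ ⊨ s ≐ t      = eval ρ s ≡ eval ρ t
  ρ ⊨ ~ φ        = ¬ (ρ ⊨ φ)
  ρ ⊨ φ ∧ ψ      = (ρ ⊨ φ) × (ρ ⊨ ψ)
  ρ ⊨ φ ∨ ψ      = (ρ ⊨ φ) ⊎ (ρ ⊨ ψ)
  ρ ⊨ forAll x φ = (a : Universe) → ρ [ x ↦ a ] ⊨ φ
  ρ ⊨ exists x φ = Σ[ a ∈ Universe ] ρ [ x ↦ a ] ⊨ φ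

Equivalent : {τ : Signature} → IsArithmetic τ → Formula τ → Formula τ → Set
Equivalent {τ} ar φ ψ =
  (S : Structure τ) → IsArithmeticStructure ar S →
  let open Semantics S in
  (ρ : Assignment) → (ρ ⊨ φ) ⇔ (ρ ⊨ ψ)

module _ {τ : Signature} where

  termVars : Term τ → List Variable
  termVars (var x)   = x ∷ []
  termVars (const c) = []
  termVars (app f t) = termVars t

  vecVars : ∀ {n} → Vec (Term τ) n → List Variable
  vecVars []       = []
  vecVars (t ∷ ts) = termVars t ++ vecVars ts

  remove : Variable → List Variable → List Variable
  remove x = filter (λ y → ¬? (y ≟ x))

  free : Formula τ → List Variable
  free (rel R ts)   = vecVars ts
  free (s ≐ t)      = termVars s ++ termVars t
  free (~ φ)        = free φ
  free (φ ∧ ψ)      = free φ ++ free ψ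
  free (φ ∨ ψ)      = free φ ++ free ψ
  free (forAll x φ) = remove x (free φ)
  free (exists x φ) = remove x (free φ)

  -- For a formula in negation normal form: the variables with a free occurrence
  -- in some literal that is not an inequality between two variables.
  core : Formula τ → List Variable
  core (~ (var x ≐ var y)) = []
  core (rel R ts)          = vecVars ts
  core (s ≐ t)             = termVars s ++ termVars t
  core (~ φ)               = core φ
  core (φ ∧ ψ)             = core φ ++ core ψ
  core (φ ∨ ψ)             = core φ ++ core ψ
  core (forAll x φ)        = remove x (core φ)
  core (exists x φ)        = remove x (core φ)

  -- The subformulas of φ outside the scope of any quantifier of φ that rebinds
  -- x: only there does the name x refer to the x of a surrounding ∃x(φ).
  subformulas : Variable → Formula τ → List (Formula τ)
  subformulas x φ@(rel R ts)   = φ ∷ []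
  subformulas x φ@(s ≐ t)      = φ ∷ []
  subformulas x φ@(~ ψ)        = φ ∷ subformulas x ψ
  subformulas x φ@(ψ ∧ χ)      = φ ∷ subformulas x ψ ++ subformulas x χ
  subformulas x φ@(ψ ∨ χ)      = φ ∷ subformulas x ψ ++ subformulas x χ
  subformulas x φ@(forAll d ψ) = φ ∷ (if ⌊ d ≟ x ⌋ then [] else subformulas x ψ)
  subformulas x φ@(exists d ψ) = φ ∷ (if ⌊ d ≟ x ⌋ then [] else subformulas x ψ)

  -- For ∀d(ψ), membership of x in free (forAll d ψ) says that x is free in ψ,
  -- so d depends on x, and that it is not d itself.
  DependentUniversal : Variable → Formula τ → Set
  DependentUniversal x (forAll d ψ) = x ∈ free (forAll d ψ)
  DependentUniversal x _            = ⊥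

  SplitConjunction : Variable → Formula τ → Set
  SplitConjunction x (α ∧ β) = x ∈ core α × x ∈ core β
  SplitConjunction x _       = ⊥

  -- The leading quantifier of ∃x(ψ) is strong.
  Strong : Variable → Formula τ → Set
  Strong x ψ = Any (DependentUniversal x) (subformulas x ψ)
             ⊎ Any (SplitConjunction x) (subformulas x ψ)

  dependentUniversal? : ∀ x φ → Dec (DependentUniversal x φ)
  dependentUniversal? x (forAll d ψ) = member? _≟_ x (free (forAll d ψ))
  dependentUniversal? x (rel R ts)   = no λ ()
  dependentUniversal? x (s ≐ t)      = no λ ()
  dependentUniversal? x (~ φ)        = no λ ()
  dependentUniversal? x (φ ∧ ψ)      = no λ ()
  dependentUniversal? x (φ ∨ ψ)      = no λ ()
  dependentUniversal? x (exists d ψ) = no λ ()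

  splitConjunction? : ∀ x φ → Dec (SplitConjunction x φ)
  splitConjunction? x (α ∧ β)      = member? _≟_ x (core α) ×-dec member? _≟_ x (core β)
  splitConjunction? x (rel R ts)   = no λ ()
  splitConjunction? x (s ≐ t)      = no λ ()
  splitConjunction? x (~ φ)        = no λ ()
  splitConjunction? x (φ ∨ ψ)      = no λ ()
  splitConjunction? x (forAll d ψ) = no λ ()
  splitConjunction? x (exists d ψ) = no λ ()

  strong? : ∀ x ψ → Dec (Strong x ψ)
  strong? x ψ = any? (dependentUniversal? x) (subformulas x ψ)
          ⊎-dec any? (splitConjunction? x) (subformulas x ψ)

  qr : Formula τ → ℕ
  qr (rel R ts)   = 0
  qr (s ≐ t)      = 0
  qr (~ φ)        = qr φ
  qr (φ ∧ ψ)      = qr φ ⊔ qr ψ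
  qr (φ ∨ ψ)      = qr φ ⊔ qr ψ
  qr (forAll x φ) = suc (qr φ)
  qr (exists x φ) = suc (qr φ)

  strong-qr : Formula τ → ℕ
  strong-qr (rel R ts)   = 0
  strong-qr (s ≐ t)      = 0
  strong-qr (~ φ)        = strong-qr φ
  strong-qr (φ ∧ ψ)      = strong-qr φ ⊔ strong-qr ψ
  strong-qr (φ ∨ ψ)      = strong-qr φ ⊔ strong-qr ψ
  strong-qr (forAll x φ) = suc (strong-qr φ)
  strong-qr (exists x φ) =
    if ⌊ strong? x φ ⌋ then suc (strong-qr φ) else strong-qr φ

  -- The lists of bound variables may repeat names; ∣_∣ counts distinct ones.
  bound : Formula τ → List Variable
  bound (rel R ts)   = []
  bound (s ≐ t)      = []
  bound (~ φ)        = bound φ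
  bound (φ ∧ ψ)      = bound φ ++ bound ψ
  bound (φ ∨ ψ)      = bound φ ++ bound ψ
  bound (forAll x φ) = x ∷ bound φ
  bound (exists x φ) = x ∷ bound φ

  strong-bound : Formula τ → List Variable
  strong-bound (rel R ts)   = []
  strong-bound (s ≐ t)      = []
  strong-bound (~ φ)        = strong-bound φ
  strong-bound (φ ∧ ψ)      = strong-bound φ ++ strong-bound ψ
  strong-bound (φ ∨ ψ)      = strong-bound φ ++ strong-bound ψ
  strong-bound (forAll x φ) = x ∷ strong-bound φ
  strong-bound (exists x φ) =
    if ⌊ strong? x φ ⌋ then x ∷ strong-bound φ else strong-bound φ

∣_∣ : List Variable → ℕ
∣ xs ∣ = length (deduplicate _≟_ xs)

-- Colour coding. Cut φ at its universal quantifiers. Inside such a piece no weakly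
-- quantified variable occurs below a further universal quantifier, and apart from
-- inequalities x ≠ y it matters for at most one literal of each conjunction. Hence,
-- once a colouring of the universe that separates the finitely many witnesses and
-- values of free variables is fixed, each weak ∃x can be replaced by a finite
-- disjunction over the colour of x: an inequality becomes a statement about colours,
-- and x itself is quantified directly at the literal that mentions it.
--
-- The colourings have two parameters p and q, which are quantified anew below every
-- universal quantifier, so that their names can be reused; this costs the factor 3.
-- Colour i means v ≡ q modulo 1 + (a k + i + 1) p for one of boundedly many a. By the
-- Chinese remainder theorem q can be chosen to give k elements w₀, …, wₖ₋₁ the colours
-- 0, …, k - 1, and some a makes all k moduli avoid the differences of the wᵢ because
-- the moduli are pairwise coprime and large, while the universe is larger than a
-- product of k of them. In a structure too small for this, the elements are named by
-- numerals and serve as their own colours.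
module Submission where

open import Defs
open import Data.Bool using (T; if_then_else_)
open import Data.Bool.Properties using (T?)
open import Data.Empty using (⊥-elim)
open import Data.Fin as Fin using (Fin; toℕ; fromℕ<)
import Data.Fin.Properties as Fin
open import Data.List using (List; []; _∷_; _++_; length; map; filter; upTo; allFin; deduplicate)
open import Data.List.Extrema.Nat using (max; xs≤max)
open import Data.List.Membership.Propositional using (_∈_; _∉_; lose)
open import Data.List.Membership.Propositional.Properties
open import Data.List.Properties
  using (length-++; length-map; length-upTo; length-tabulate; filter-notAll)
open import Data.List.Relation.Binary.Subset.Propositional using (_⊆_)
open import Data.List.Relation.Unary.All as All using (All)
open import Data.List.Relation.Unary.All.Properties using (All¬⇒¬Any)
open import Data.List.Relation.Unary.AllPairs using (_∷_)
open import Data.List.Relation.Unary.Any using (Any; here; there)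
open import Data.List.Relation.Unary.Any.Properties using (++⁺ˡ; ++⁺ʳ)
open import Data.List.Relation.Unary.Unique.Propositional using (Unique)
open import Data.List.Relation.Unary.Unique.DecPropositional.Properties using (deduplicate-!)
open import Data.Maybe using (Maybe; just; nothing)
open import Data.Maybe.Properties using (just-injective)
open import Data.Nat hiding (compare)
open import Data.Nat.Coprimality as Coprime using (Coprime; coprime-divisor)
open import Data.Nat.Divisibility
open import Data.Nat.DivMod
open import Data.Nat.Properties
open import Data.Nat.Tactic.RingSolver using (solve-∀)
open import Data.List.Membership.DecPropositional _≟_ using (_∈?_)
open import Data.Product using (Σ-syntax; ∃; _×_; _,_; proj₁; proj₂)
open import Data.Sum as Sum using (_⊎_; inj₁; inj₂)
open import Data.Vec using (Vec; []; _∷_) renaming (map to vmap)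
open import Function using (_∘_; id)
open import Function.Bundles using (_⇔_; mk⇔; module Equivalence)
open import Function.Definitions using (Injective)
open import Relation.Binary.Definitions using (tri<; tri≈; tri>)
open import Relation.Binary.PropositionalEquality
open import Relation.Binary.Structures using (IsStrictTotalOrder)
open import Relation.Nullary using (¬_; Dec; yes; no; contradiction; ⌊_⌋)
open import Relation.Nullary.Decidable using (map′; ¬?)
open import Relation.Unary using (Decidable)

open Equivalence using (to; from)

-- Separating finitely many numbers by few moduli

-- A missed value could be punched out of the codomain, leaving an injection from `Fin (suc n)` to
-- `Fin n`. The principle is applied both to residues and to ranks of elements.
injective⇒surjective : ∀ {n} (f : Fin n → Fin n) → Injective _≡_ _≡_ f →
                       ∀ y → ∃ λ x → f x ≡ y
injective⇒surjective {suc n} f inj y with Fin.any? (λ x → f x Fin.≟ y)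
... | yes hit  = hit
... | no  miss = contradiction (Fin.injective⇒≤ squeeze-injective) 1+n≰n
  where
  avoid : ∀ x → y ≢ f x
  avoid x y≡fx = miss (x , sym y≡fx)
  squeeze : Fin (suc n) → Fin n
  squeeze x = Fin.punchOut (avoid x)
  squeeze-injective : Injective _≡_ _≡_ squeeze
  squeeze-injective {x} {x'} eq = inj (Fin.punchOut-injective (avoid x) (avoid x') eq)

-- Products of coprime moduli and the Chinese remainder theorem

∏ : ℕ → (ℕ → ℕ) → ℕ
∏ zero    f = 1
∏ (suc k) f = ∏ k f * f k

∣∏ : ∀ {k i} f → i < k → f i ∣ ∏ k f
∣∏ {suc k} {i} f i<1+k with m≤n⇒m<n∨m≡n (s≤s⁻¹ i<1+k)
... | inj₁ i<k  = ∣m⇒∣m*n (f k) (∣∏ f i<k)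
... | inj₂ refl = n∣m*n (∏ k f)

∏≤^ : ∀ k f b → (∀ i → i < k → f i ≤ b) → ∏ k f ≤ b ^ k
∏≤^ zero    f b f≤b = ≤-refl
∏≤^ (suc k) f b f≤b = ≤-trans
  (*-mono-≤ (∏≤^ k f b (λ i i<k → f≤b i (m<n⇒m<1+n i<k))) (f≤b k ≤-refl))
  (≤-reflexive (*-comm (b ^ k) b))

∏-positive : ∀ k f → (∀ i → 0 < f i) → 0 < ∏ k f
∏-positive zero    f 0<f = s≤s z≤n
∏-positive (suc k) f 0<f = *-mono-< {0} {_} {0} (∏-positive k f 0<f) (0<f k)

coprime-* : ∀ {a b c} → Coprime a c → Coprime b c → Coprime (a * b) c
coprime-* {a} {b} {c} a⊥c b⊥c {d} (d∣ab , d∣c) = b⊥c (coprime-divisor d⊥a d∣ab , d∣c)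
  where
  d⊥a : Coprime d a
  d⊥a (e∣d , e∣a) = a⊥c (e∣a , ∣-trans e∣d d∣c)

coprime-∏ : ∀ k f {c} → (∀ i → i < k → Coprime (f i) c) → Coprime (∏ k f) c
coprime-∏ zero    f f⊥c (d∣1 , _) = ∣1⇒≡1 d∣1
coprime-∏ (suc k) f f⊥c =
  coprime-* (coprime-∏ k f (λ i i<k → f⊥c i (m<n⇒m<1+n i<k))) (f⊥c k ≤-refl)

coprime⇒*∣ : ∀ {a b c} → Coprime a b → a ∣ c → b ∣ c → a * b ∣ c
coprime⇒*∣ {a} {b} a⊥b (divides e refl) b∣ea =
  subst (a * b ∣_) (*-comm a e)
    (*-monoʳ-∣ a (coprime-divisor (Coprime.sym a⊥b) (subst (b ∣_) (*-comm e a) b∣ea)))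

%≡⇒∣∣-∣ : ∀ a b m .{{_ : NonZero m}} → a % m ≡ b % m → m ∣ ∣ a - b ∣
%≡⇒∣∣-∣ a b m a≡b = divides ∣ a / m - b / m ∣ (begin
  ∣ a - b ∣                                         ≡⟨ cong₂ ∣_-_∣ (m≡m%n+[m/n]*n a m) (m≡m%n+[m/n]*n b m) ⟩
  ∣ a % m + a / m * m - b % m + b / m * m ∣         ≡⟨ cong (λ r → ∣ r + a / m * m - b % m + b / m * m ∣) a≡b ⟩
  ∣ b % m + a / m * m - b % m + b / m * m ∣         ≡⟨ ∣m+n-m+o∣≡∣n-o∣ (b % m) _ _ ⟩
  ∣ a / m * m - b / m * m ∣                         ≡⟨ *-distribʳ-∣-∣ m (a / m) (b / m) ⟨
  ∣ a / m - b / m ∣ * m                             ∎)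
  where open ≡-Reasoning

-- The residues q + P u for u < m are pairwise distinct modulo m, so by
-- counting they hit every residue.
hit-residue : ∀ P m .{{_ : NonZero m}} → Coprime P m → ∀ q w →
              Σ[ u ∈ ℕ ] u < m × (q + P * u) % m ≡ w % m
hit-residue P m P⊥m q w =
  toℕ u , Fin.toℕ<n u , (begin
    (q + P * toℕ u) % m                    ≡⟨ Fin.toℕ-fromℕ< (m%n<n (q + P * toℕ u) m) ⟨
    toℕ (residue u)                        ≡⟨ cong toℕ (proj₂ hit) ⟩
    toℕ (fromℕ< (m%n<n w m))               ≡⟨ Fin.toℕ-fromℕ< (m%n<n w m) ⟩
    w % m                                  ∎)
  where
  open ≡-Reasoning
  residue : Fin m → Fin m
  residue u = fromℕ< (m%n<n (q + P * toℕ u) m)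
  residue-injective : Injective _≡_ _≡_ residue
  residue-injective {u} {v} eq = Fin.toℕ-injective (∣m-n∣≡0⇒m≡n (small _ m∣∣u-v∣
      (≤-<-trans (∣m-n∣≤m⊔n (toℕ u) (toℕ v)) (⊔-pres-<m (Fin.toℕ<n u) (Fin.toℕ<n v)))))
    where
    m∣P*∣u-v∣ : m ∣ P * ∣ toℕ u - toℕ v ∣
    m∣P*∣u-v∣ = subst (m ∣_)
      (trans (∣m+n-m+o∣≡∣n-o∣ q _ _) (sym (*-distribˡ-∣-∣ P (toℕ u) (toℕ v))))
      (%≡⇒∣∣-∣ (q + P * toℕ u) (q + P * toℕ v) m (Fin.fromℕ<-injective _ _ _ _ eq))
    m∣∣u-v∣ : m ∣ ∣ toℕ u - toℕ v ∣
    m∣∣u-v∣ = coprime-divisor (Coprime.sym P⊥m) m∣P*∣u-v∣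
    small : ∀ d → m ∣ d → d < m → d ≡ 0
    small zero    _   _   = refl
    small (suc d) m∣d d<m = contradiction d<m (≤⇒≯ (∣⇒≤ m∣d))
  hit = injective⇒surjective residue residue-injective (fromℕ< (m%n<n w m))
  u = proj₁ hit

-- Adding a multiple of the product of the earlier moduli keeps their residues, and `hit-residue`
-- finds the multiple that serves the new modulus. The bound on q matters later, when q has to be
-- the rank of an element of the universe.
chinese-remainder : ∀ k (f : ℕ → ℕ) → let m = suc ∘ f in
  (∀ i j → i < j → j < k → Coprime (m i) (m j)) → (w : ℕ → ℕ) →
  Σ[ q ∈ ℕ ] q < ∏ k m × (∀ i → i < k → q % m i ≡ w i % m i)
chinese-remainder zero    f m⊥m w = 0 , s≤s z≤n , λ _ ()
chinese-remainder (suc k) f m⊥m w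
  with q , q<P , q≡w ← chinese-remainder k f (λ i j i<j j<k → m⊥m i j i<j (m<n⇒m<1+n j<k)) w
  with u , u<m , qPu≡w ← hit-residue (∏ k (suc ∘ f)) (suc (f k))
         (coprime-∏ k (suc ∘ f) (λ i i<k → m⊥m i k i<k ≤-refl)) q (w k)
  = q + ∏ k (suc ∘ f) * u , q′<∏ , λ i i<1+k → residues i (m≤n⇒m<n∨m≡n (s≤s⁻¹ i<1+k))
  where
  m : ℕ → ℕ
  m = suc ∘ f
  q′<∏ : q + ∏ k m * u < ∏ k m * m k
  q′<∏ = ≤-trans (+-monoˡ-< (∏ k m * u) q<P)
    (≤-trans (≤-reflexive (sym (*-suc (∏ k m) u))) (*-monoʳ-≤ (∏ k m) u<m))
  residues : ∀ i → i < k ⊎ i ≡ k → (q + ∏ k m * u) % m i ≡ w i % m i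
  residues i (inj₁ i<k)  =
    trans (%-remove-+ʳ q (∣m⇒∣m*n u (∣∏ m i<k))) (q≡w i i<k)
  residues i (inj₂ refl) = qPu≡w

-- The moduli 1 + (j + 1) p of Gödel's beta function

modulus : ℕ → ℕ → ℕ
modulus p j = suc (suc j * p)

-- A common divisor divides (j + 1) mᵢ - (i + 1) mⱼ = j - i, hence p by hypothesis, hence mᵢ - (i +
-- 1) p = 1.
modulus-coprime : ∀ p i j → i < j → (∀ e → suc e ≤ j → suc e ∣ p) →
                  Coprime (modulus p i) (modulus p j)
modulus-coprime p i j i<j small∣p {d} (d∣mᵢ , d∣mⱼ) =
  ∣1⇒≡1 (∣m+n∣m⇒∣n (subst (d ∣_) (+-comm 1 (suc i * p)) d∣mᵢ) (∣n⇒∣m*n (suc i) d∣p))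
  where
  e : ℕ
  e = j ∸ suc i
  j≡ : suc (i + e) ≡ j
  j≡ = m+[n∸m]≡n i<j
  combination : suc (suc (i + e)) * modulus p i ≡ suc i * modulus p (suc (i + e)) + suc e
  combination = identity i e p
    where
    identity : ∀ i e p → suc (suc (i + e)) * suc (suc i * p)
                       ≡ suc i * suc (suc (suc (i + e)) * p) + suc e
    identity = solve-∀
  d∣1+e : d ∣ suc e
  d∣1+e = ∣m+n∣m⇒∣n
    (subst (d ∣_) combination (∣n⇒∣m*n (suc (suc (i + e))) d∣mᵢ))
    (∣n⇒∣m*n (suc i) (subst (λ j → d ∣ modulus p j) (sym j≡) d∣mⱼ))
  d∣p : d ∣ p
  d∣p = ∣-trans d∣1+e (small∣p e (subst (suc e ≤_) j≡ (s≤s (m≤n+m e i))))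

-- If each of the A blocks contained a divisor of D, then D would be divisible by
-- the product of these pairwise coprime divisors, which is at least p ^ A.
good-block : ∀ k p D A .{{_ : NonZero D}} → (∀ e → suc e ≤ A * k → suc e ∣ p) → D < p ^ A →
             Σ[ a ∈ ℕ ] a < A × (∀ i → i < k → ¬ modulus p (a * k + i) ∣ D)
good-block k p D A small∣p D<p^A with search A ≤-refl
  where
  -- Invariant after a unsuccessful blocks: P is the product of one divisor of D from each of them,
  -- and it is coprime to every modulus of the blocks still to come.
  Many : ℕ → Set
  Many a = Σ[ P ∈ ℕ ] P ∣ D × p ^ a ≤ P ×
           (∀ j → a * k ≤ j → j < A * k → Coprime P (modulus p j))
  search : ∀ a → a ≤ A →
    (Σ[ b ∈ ℕ ] b < A × (∀ i → i < k → ¬ modulus p (b * k + i) ∣ D)) ⊎ Many a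
  search zero    _   = inj₂ (1 , 1∣ D , ≤-refl , λ _ _ _ p → ∣1⇒≡1 (proj₁ p))
  search (suc a) a<A with search a (<⇒≤ a<A) | anyUpTo? (λ i → modulus p (a * k + i) ∣? D) k
  ... | inj₁ found | _ = inj₁ found
  ... | inj₂ _ | no none = inj₁ (a , a<A , λ i i<k m∣D → none (i , i<k , m∣D))
  ... | inj₂ (P , P∣D , p^a≤P , P⊥) | yes (i , i<k , m∣D) = inj₂
    ( P * modulus p j
    , coprime⇒*∣ (P⊥ j (m≤m+n (a * k) i) (<-≤-trans j<next next≤)) P∣D m∣D
    , ≤-trans (≤-reflexive (*-comm p (p ^ a))) (*-mono-≤ p^a≤P (m≤n⇒m≤1+n (m≤m+n p (j * p))))
    , λ l next≤l l<Ak → coprime-*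
        (P⊥ l (≤-trans (m≤n+m (a * k) k) next≤l) l<Ak)
        (modulus-coprime p j l (<-≤-trans j<next next≤l)
          (λ e e<l → small∣p e (≤-trans e<l (<⇒≤ l<Ak)))) )
    where
    j : ℕ
    j = a * k + i
    j<next : j < suc a * k
    j<next = subst (j <_) (+-comm (a * k) k) (+-monoʳ-< (a * k) i<k)
    next≤ : suc a * k ≤ A * k
    next≤ = *-monoˡ-≤ k a<A
... | inj₁ found = found
... | inj₂ (P , P∣D , p^A≤P , _) = contradiction (≤-trans p^A≤P (∣⇒≤ P∣D)) (<⇒≱ D<p^A)

root : ∀ e n → Σ[ s ∈ ℕ ] s ^ suc e ≤ n × n < suc s ^ suc e
root e zero = 0 , z≤n , m^n>0 1 (suc e)
root e (suc n) with root e n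
... | s , s^e≤n , n<s'^e with suc n <? suc s ^ suc e
...   | yes lt = s , m≤n⇒m≤1+n s^e≤n , lt
...   | no ≮   = suc s , ≮⇒≥ ≮ , ≤-<-trans n<s'^e (^-monoˡ-< (suc e) (n<1+n (suc s)))

-- The value 1 instead of 0 at equal arguments keeps the product of all distances positive, while
-- that product remains a multiple of every nonzero difference.
distance : ℕ → ℕ → ℕ
distance x y = if ⌊ x ≟ y ⌋ then 1 else ∣ x - y ∣

distance-positive : ∀ x y → 0 < distance x y
distance-positive x y with x ≟ y
... | yes _   = s≤s z≤n
... | no  x≢y = n≢0⇒n>0 (x≢y ∘ ∣m-n∣≡0⇒m≡n)

distance≤ : ∀ {n} x y → x < n → y < n → distance x y ≤ n
distance≤ x y x<n y<n with x ≟ y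
... | yes _ = ≤-trans (s≤s z≤n) x<n
... | no  _ = <⇒≤ (≤-<-trans (∣m-n∣≤m⊔n x y) (⊔-pres-<m x<n y<n))

∣∣-∣⇒∣distance : ∀ {d} x y → x ≢ y → d ∣ ∣ x - y ∣ → d ∣ distance x y
∣∣-∣⇒∣distance x y x≢y d∣ with x ≟ y
... | yes x≡y = contradiction x≡y x≢y
... | no  _   = d∣

-- With e = k + 1 and s the integral e-th root of n, the number p = indices ! * 2 s
-- satisfies n < p ^ e, so few of the moduli built from p divide a number below n;
-- yet p is so close to s that k of these moduli multiply to less than n.
module Separation (k : ℕ) .{{k≢0 : NonZero k}} where

  blocks indices scale threshold : ℕ
  -- The product D of the k * k distances is at most n ^ (k * k), and n < p ^ (k + 1), so D < p ^
  -- `blocks` as `good-block` demands. All moduli are at most `scale` * s, and `threshold` forces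
  -- `scale` ^ k < s, so that (`scale` * s) ^ k < s ^ (k + 1) ≤ n.
  blocks    = suc k * (k * k)
  indices   = blocks * k
  scale     = suc (indices * (indices !)) + indices * (indices !)
  threshold = suc (scale ^ k) ^ suc k

  module _ (n : ℕ) (threshold≤n : threshold ≤ n) (w : ℕ → ℕ) (w<n : ∀ i → w i < n) where

    private
      s p D : ℕ
      s = proj₁ (root k n)
      -- The factorial makes every positive number up to `indices` divide p, which the coprimality
      -- of the moduli requires; the doubling gives p ≥ s + 1 and thus n < p ^ (k + 1).
      p = (indices !) * (s + s)
      -- A modulus that does not divide D divides no nonzero difference of the numbers w i with i <
      -- k.
      D = ∏ k (λ i → ∏ k (λ j → distance (w i) (w j)))

      s^e≤n : s ^ suc k ≤ n
      s^e≤n = proj₁ (proj₂ (root k n))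

      scale^k<s : scale ^ k < s
      scale^k<s with scale ^ k <? s
      ... | yes lt = lt
      ... | no  ≮s = contradiction threshold≤n (<⇒≱ (<-≤-trans (proj₂ (proj₂ (root k n)))
                       (^-monoˡ-≤ (suc k) (s≤s (≮⇒≥ ≮s)))))

      s<p : suc s ≤ p
      s<p = ≤-trans (+-monoˡ-≤ s (≤-trans (s≤s z≤n) scale^k<s))
        (≤-trans (≤-reflexive (sym (*-identityˡ (s + s)))) (*-monoˡ-≤ (s + s) (n!>0 indices)))
        where
        n!>0 : ∀ m → 1 ≤ m !
        n!>0 m = >-nonZero⁻¹ (m !) {{m !≢0}}

      n<p^e : n < p ^ suc k
      n<p^e = <-≤-trans (proj₂ (proj₂ (root k n))) (^-monoˡ-≤ (suc k) s<p)

      D≤ : D ≤ n ^ (k * k)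
      D≤ = ≤-trans (∏≤^ k _ (n ^ k) (λ i _ → ∏≤^ k _ n (λ j _ → distance≤ (w i) (w j) (w<n i) (w<n j))))
                   (≤-reflexive (^-*-assoc n k k))

      D<p^A : D < p ^ blocks
      D<p^A = ≤-<-trans D≤ (<-≤-trans (^-monoˡ-< (k * k) {{m*n≢0 k k}} n<p^e)
                (≤-reflexive (^-*-assoc p (suc k) (k * k))))

      D>0 : 0 < D
      D>0 = ∏-positive k _ (λ i → ∏-positive k _ (λ j → distance-positive (w i) (w j)))

      small∣p : ∀ e → suc e ≤ indices → suc e ∣ p
      small∣p e e<t = ∣m⇒∣m*n (s + s) (∣-trans (m∣m*n (e !)) (m≤n⇒m!∣n! e<t))

      b : ℕ
      b = suc (indices * p)

      b^k<n : b ^ k < n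
      b^k<n = <-≤-trans (≤-<-trans (^-monoˡ-≤ k b≤) (subst (_< s ^ suc k) (sym (^-distribʳ-* k scale s))
                (*-monoˡ-< (s ^ k) {{m^n≢0 s k {{s≢0}}}} scale^k<s))) s^e≤n
        where
        s≢0 : NonZero s
        s≢0 = >-nonZero (≤-trans (s≤s z≤n) scale^k<s)
        ^-distribʳ-* : ∀ e x y → (x * y) ^ e ≡ x ^ e * y ^ e
        ^-distribʳ-* zero    x y = refl
        ^-distribʳ-* (suc e) x y = trans (cong (x * y *_) (^-distribʳ-* e x y)) (shuffle x y (x ^ e) (y ^ e))
          where
          shuffle : ∀ x y u v → x * y * (u * v) ≡ x * u * (y * v)
          shuffle = solve-∀
        b≤ : b ≤ scale * s
        b≤ = ≤-trans (+-monoˡ-≤ (indices * p) (≤-trans (s≤s z≤n) scale^k<s))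
                     (≤-reflexive (expand indices (indices !) s))
          where
          expand : ∀ t f s → s + t * (f * (s + s)) ≡ (suc (t * f) + t * f) * s
          expand = solve-∀

      b<n : b < n
      b<n = ≤-<-trans (≤-trans (≤-reflexive (sym (*-identityʳ b))) (^-monoʳ-≤ b {1} {k} (>-nonZero⁻¹ k))) b^k<n

    record Separated : Set where
      field
        block multiplier remainder : ℕ
        block<      : block < blocks
        remainder<  : remainder < n
        multiplier>0 : 0 < multiplier
        modulus<    : ∀ i → i < k → modulus multiplier (block * k + i) < n
        congruent   : ∀ i → i < k → let m = modulus multiplier (block * k + i) in
                      remainder % m ≡ w i % m
        separated   : ∀ i l → i < k → l < k → let m = modulus multiplier (block * k + i) in
                      w l % m ≡ w i % m → w l ≡ w i

    abstract
      separate : Separated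
      separate
        with a , a<A , good ← good-block k p D blocks {{>-nonZero D>0}} small∣p D<p^A
        = record
        { block      = a
        ; multiplier = p
        ; remainder  = proj₁ crt
        ; block<     = a<A
        ; remainder< = <-trans (<-≤-trans (proj₁ (proj₂ crt)) (∏≤^ k _ b m≤b)) b^k<n
        ; multiplier>0 = ≤-<-trans z≤n s<p
        ; modulus<   = λ i i<k → ≤-<-trans (m≤b i i<k) b<n
        ; congruent  = proj₂ (proj₂ crt)
        ; separated  = sep
        }
        where
        index< : ∀ i → i < k → a * k + i < indices
        index< i i<k = <-≤-trans (+-monoʳ-< (a * k) i<k)
          (≤-trans (≤-reflexive (+-comm (a * k) k)) (*-monoˡ-≤ k a<A))
        m≤b : ∀ i → i < k → modulus p (a * k + i) ≤ b
        m≤b i i<k = s≤s (*-monoˡ-≤ p (index< i i<k))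
        crt : Σ[ q ∈ ℕ ] q < ∏ k (λ i → modulus p (a * k + i)) ×
              (∀ i → i < k → q % modulus p (a * k + i) ≡ w i % modulus p (a * k + i))
        crt = chinese-remainder k (λ i → suc (a * k + i) * p)
          (λ i j i<j j<k → modulus-coprime p (a * k + i) (a * k + j) (+-monoʳ-< (a * k) i<j)
            (λ e e<j → small∣p e (≤-trans e<j (<⇒≤ (index< j j<k))))) w
        sep : ∀ i l → i < k → l < k → w l % modulus p (a * k + i) ≡ w i % modulus p (a * k + i) → w l ≡ w i
        sep i l i<k l<k eq with w l ≟ w i
        ... | yes same = same
        ... | no  diff = contradiction
          (∣-trans (∣∣-∣⇒∣distance (w l) (w i) diff (%≡⇒∣∣-∣ (w l) (w i) (modulus p (a * k + i)) eq))
            (∣-trans (∣∏ (λ j → distance (w l) (w j)) i<k)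
                     (∣∏ (λ i → ∏ k (λ j → distance (w i) (w j))) l<k)))
          (good i i<k)

-- Arithmetic in finite structures

module _ {A : Set} {P Q : A → Set} (P? : Decidable P) (Q? : Decidable Q)
         (P⊆Q : ∀ {x} → P x → Q x) where

  length-filter-mono : ∀ xs → length (filter P? xs) ≤ length (filter Q? xs)
  length-filter-mono [] = z≤n
  length-filter-mono (x ∷ xs) with P? x | Q? x
  ... | yes _  | yes _  = s≤s (length-filter-mono xs)
  ... | yes px | no ¬qx = contradiction (P⊆Q px) ¬qx
  ... | no _   | yes _  = m≤n⇒m≤1+n (length-filter-mono xs)
  ... | no _   | no _   = length-filter-mono xs

  length-filter-mono-< : ∀ {xs y} → y ∈ xs → ¬ P y → Q y →
                         length (filter P? xs) < length (filter Q? xs)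
  length-filter-mono-< {x ∷ xs} (here refl) ¬px qx with P? x | Q? x
  ... | yes px | _      = contradiction px ¬px
  ... | no _   | yes _  = s≤s (length-filter-mono xs)
  ... | no _   | no ¬qx = contradiction qx ¬qx
  length-filter-mono-< {x ∷ xs} (there y∈xs) ¬py qy with P? x | Q? x
  ... | yes _  | yes _  = s≤s (length-filter-mono-< y∈xs ¬py qy)
  ... | yes px | no ¬qx = contradiction (P⊆Q px) ¬qx
  ... | no _   | yes _  = m≤n⇒m≤1+n (length-filter-mono-< y∈xs ¬py qy)
  ... | no _   | no _   = length-filter-mono-< y∈xs ¬py qy

module Ranks {τ : Signature} (ar : IsArithmetic τ) (S : Structure τ)
             (S-arith : IsArithmeticStructure ar S) where

  open IsArithmetic ar public renaming (zero to zero′; succ to succ′)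
  open Structure S public
  open IsArithmeticStructure S-arith public
  open IsStrictTotalOrder lt-linear using (compare; irrefl) renaming (trans to ≺-trans)

  rk : Universe → ℕ
  rk = rank ar S

  _≺_ : Universe → Universe → Set
  x ≺ y = T (⟦ lt ⟧ʳ (x ∷ y ∷ []))

  rk-mono : ∀ {x y} → x ≺ y → rk x < rk y
  rk-mono {x} {y} x≺y = length-filter-mono-<
    (λ z → T? (⟦ lt ⟧ʳ (z ∷ x ∷ []))) (λ z → T? (⟦ lt ⟧ʳ (z ∷ y ∷ [])))
    (λ z≺x → ≺-trans z≺x x≺y) (∈-allFin x) (irrefl refl) x≺y

  rk-injective : Injective _≡_ _≡_ rk
  rk-injective {x} {y} eq with compare x y
  ... | tri< x≺y _ _ = contradiction eq (<⇒≢ (rk-mono x≺y))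
  ... | tri≈ _ x≡y _ = x≡y
  ... | tri> _ _ y≺x = contradiction (sym eq) (<⇒≢ (rk-mono y≺x))

  rk<size : ∀ x → rk x < size
  rk<size x = subst (rk x <_) (length-tabulate {n = size} (λ i → i))
    (filter-notAll (λ z → T? (⟦ lt ⟧ʳ (z ∷ x ∷ []))) (allFin size) (lose (∈-allFin x) (irrefl refl)))

  -- Ranks are injective and below `size`, so by counting they exhaust the numbers below `size`.
  rk-surjective : ∀ {k} → k < size → ∃ λ x → rk x ≡ k
  rk-surjective {k} k<size = proj₁ hit , (begin
    rk (proj₁ hit)                 ≡⟨ Fin.toℕ-fromℕ< (rk<size _) ⟨
    toℕ (rankFin (proj₁ hit))      ≡⟨ cong toℕ (proj₂ hit) ⟩
    toℕ (fromℕ< k<size)            ≡⟨ Fin.toℕ-fromℕ< k<size ⟩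
    k                              ∎)
    where
    open ≡-Reasoning
    rankFin : Universe → Universe
    rankFin x = fromℕ< (rk<size x)
    hit = injective⇒surjective rankFin
      (λ eq → rk-injective (Fin.fromℕ<-injective _ _ _ _ eq)) (fromℕ< k<size)

  numeralValue : ℕ → Universe
  numeralValue zero    = ⟦ zero′ ⟧ᶜ
  numeralValue (suc k) = ⟦ succ′ ⟧ᶠ (numeralValue k)

  -- The premise excludes the maximum, whose successor has no prescribed value. Accordingly numerals
  -- are only evaluated below `size`.
  rk-succ : ∀ {x} → suc (rk x) < size → rk (⟦ succ′ ⟧ᶠ x) ≡ suc (rk x)
  rk-succ {x} lt with y , rk-y ← rk-surjective lt =
    trans (cong rk (succ-natural x y rk-y)) rk-y

  rk-numeral : ∀ {k} → k < size → rk (numeralValue k) ≡ k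
  rk-numeral {zero}  _  = zero-natural
  rk-numeral {suc k} lt = trans (rk-succ (subst (λ r → suc r < size) (sym ih) lt)) (cong suc ih)
    where ih = rk-numeral (<⇒≤ lt)

  -- With j + 1 denoted by a numeral, the elements v and q are congruent modulo
  -- 1 + (j + 1) p; either of the two may be the larger.
  Matrix : ℕ → (p q t u s v : Universe) → Set
  Matrix j p q t u s v =
    T (⟦ mult ⟧ʳ (numeralValue (suc j) ∷ p ∷ t ∷ [])) ×
    T (⟦ mult ⟧ʳ (⟦ succ′ ⟧ᶠ t ∷ u ∷ s ∷ [])) ×
    (T (⟦ add ⟧ʳ (s ∷ q ∷ v ∷ [])) ⊎ T (⟦ add ⟧ʳ (s ∷ v ∷ q ∷ [])))

  Congruent : ℕ → (p q v : Universe) → Set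
  Congruent j p q v = Σ[ t ∈ Universe ] Σ[ u ∈ Universe ] Σ[ s ∈ Universe ] Matrix j p q t u s v

  module _ (j : ℕ) {p q v : Universe} (p>0 : 0 < rk p) (m<size : modulus (rk p) j < size) where

    private
      m : ℕ
      m = modulus (rk p) j

      rk-1+j : rk (numeralValue (suc j)) ≡ suc j
      -- The numeral has its intended value because j + 1 ≤ (j + 1) p < m < `size`; the first
      -- inequality uses p > 0.
      rk-1+j = rk-numeral (≤-<-trans (m≤m*n (suc j) (rk p) {{>-nonZero p>0}}) (<⇒≤ m<size))

      multiple% : ∀ {a b} u → m * u + a ≡ b → b % m ≡ a % m
      multiple% {a} u refl = trans (cong (_% m) (trans (+-comm (m * u) a) (cong (a +_) (*-comm m u))))
                                   ([m+kn]%n≡m%n a u m)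

      multiple : ∀ {a b} → a ≤ b → a % m ≡ b % m → Σ[ u ∈ ℕ ] m * u + a ≡ b
      multiple {a} {b} a≤b a≡b with divides u eq ← %≡⇒∣∣-∣ a b m a≡b =
        u , (begin
          m * u + a      ≡⟨ cong (_+ a) (*-comm m u) ⟩
          u * m + a      ≡⟨ cong (_+ a) eq ⟨
          ∣ a - b ∣ + a  ≡⟨ cong (_+ a) (m≤n⇒∣m-n∣≡n∸m a≤b) ⟩
          b ∸ a + a      ≡⟨ m∸n+n≡m a≤b ⟩
          b              ∎)
        where open ≡-Reasoning

    congruent⇒% : Congruent j p q v → rk v % m ≡ rk q % m
    congruent⇒% (t , u , s , jpt , tus , sum) = finish sum
      where
      rk-t : suc j * rk p ≡ rk t
      rk-t = trans (cong (_* rk p) (sym rk-1+j)) (to (mult-natural _ _ _) jpt)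
      rk-s : m * rk u ≡ rk s
      rk-s = trans (cong (_* rk u) (sym (trans (rk-succ (subst (λ r → suc r < size) rk-t m<size))
                                               (cong suc (sym rk-t)))))
                   (to (mult-natural _ _ _) tus)
      finish : _ → rk v % m ≡ rk q % m
      finish (inj₁ sqv) = multiple% (rk u) (trans (cong (_+ rk q) rk-s) (to (add-natural _ _ _) sqv))
      finish (inj₂ svq) = sym (multiple% (rk u) (trans (cong (_+ rk v) rk-s) (to (add-natural _ _ _) svq)))

    -- The numbers (j + 1) p, u and m u are all below `size`, so there are elements of these ranks
    -- to serve as t, u and s. The last premise leaves open which of q and v is the larger.
    congruent⁺ : ∀ u → m * u < size →
      (∀ s → m * u ≡ rk s → T (⟦ add ⟧ʳ (s ∷ q ∷ v ∷ [])) ⊎ T (⟦ add ⟧ʳ (s ∷ v ∷ q ∷ []))) →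
      Congruent j p q v
    congruent⁺ u mu<size sum
      with t , rk-t ← rk-surjective (<⇒≤ m<size)
      with u' , rk-u ← rk-surjective (≤-<-trans (m≤n*m u m) mu<size)
      with s , rk-s ← rk-surjective mu<size
      = t , u' , s
      , from (mult-natural _ _ _) (trans (cong (_* rk p) rk-1+j) (sym rk-t))
      , from (mult-natural _ _ _) (trans
          (cong₂ _*_ (trans (rk-succ (subst (λ r → suc r < size) (sym rk-t) m<size)) (cong suc rk-t)) rk-u)
          (sym rk-s))
      , sum s (sym rk-s)

    %⇒congruent : rk v % m ≡ rk q % m → Congruent j p q v
    %⇒congruent v≡q with ≤-total (rk q) (rk v)
    ... | inj₁ q≤v with u , eq ← multiple q≤v (sym v≡q) =
      congruent⁺ u (≤-<-trans (m+n≤o⇒m≤o _ (≤-reflexive eq)) (rk<size v))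
        (λ s rk-s → inj₁ (from (add-natural _ _ _) (trans (cong (_+ rk q) (sym rk-s)) eq)))
    ... | inj₂ v≤q with u , eq ← multiple v≤q v≡q =
      congruent⁺ u (≤-<-trans (m+n≤o⇒m≤o _ (≤-reflexive eq)) (rk<size q))
        (λ s rk-s → inj₂ (from (add-natural _ _ _) (trans (cong (_+ rk v) (sym rk-s)) eq)))

-- Colourings with two parameters

data Scheme : Set where
  byNumeral : Scheme
  byResidue : ℕ → Scheme

schemes : (k : ℕ) .{{_ : NonZero k}} → List Scheme
schemes k = byNumeral ∷ map byResidue (upTo (Separation.blocks k))

palette : (k : ℕ) .{{_ : NonZero k}} → Scheme → ℕ
palette k byNumeral     = Separation.threshold k
palette k (byResidue a) = k

-- An element may satisfy several of the congruences, and numerals may repeat past the maximum.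
-- Taking the least index makes the colour of an element unique.
First : (ℕ → Set) → ℕ → Set
First B c = (∀ {c'} → c' < c → ¬ B c') × B c

first-unique : ∀ {B c c'} → First B c → First B c' → c ≡ c'
first-unique {c = c} {c'} (c-first , bc) (c'-first , bc') with <-cmp c c'
... | tri< c<c' _ _ = contradiction bc (c'-first c<c')
... | tri≈ _ c≡c' _ = c≡c'
... | tri> _ _ c'<c = contradiction bc' (c-first c'<c)

first : ∀ {B : ℕ → Set} n → (∀ c → c < n → Dec (B c)) → ∀ c → c < n → B c →
        Σ[ d ∈ ℕ ] d < n × First B d
first {B} n B? c c<n bc with search n ≤-refl
  where
  search : ∀ m → m ≤ n → (∀ {d} → d < m → ¬ B d) ⊎ Σ[ d ∈ ℕ ] d < n × First B d
  search zero    _ = inj₁ λ ()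
  search (suc m) m<n with search m (<⇒≤ m<n) | B? m m<n
  ... | inj₂ found | _      = inj₂ found
  ... | inj₁ none  | yes bm = inj₂ (m , m<n , none , bm)
  ... | inj₁ none  | no ¬bm = inj₁ λ {d} d<1+m bd → extend (m≤n⇒m<n∨m≡n (s≤s⁻¹ d<1+m)) bd
    where
    extend : ∀ {d} → d < m ⊎ d ≡ m → ¬ B d
    extend (inj₁ d<m)  = none d<m
    extend (inj₂ refl) = ¬bm
... | inj₁ none  = contradiction bc (none c<n)
... | inj₂ found = found

-- Total, because `separate` takes a function on all of ℕ. The default 0 is a rank in every nonempty
-- universe.
nth : List ℕ → ℕ → ℕ
nth []       i       = 0
nth (x ∷ xs) zero    = x
nth (x ∷ xs) (suc i) = nth xs i

∈⇒nth : ∀ {x xs} → x ∈ xs → Σ[ i ∈ ℕ ] i < length xs × nth xs i ≡ x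
∈⇒nth (here refl) = 0 , s≤s z≤n , refl
∈⇒nth (there x∈xs) with i , i< , eq ← ∈⇒nth x∈xs = suc i , s≤s i< , eq

nth< : ∀ {n} xs → 0 < n → (∀ {x} → x ∈ xs → x < n) → ∀ i → nth xs i < n
nth< []       0<n xs<n i       = 0<n
nth< (x ∷ xs) 0<n xs<n zero    = xs<n (here refl)
nth< (x ∷ xs) 0<n xs<n (suc i) = nth< xs 0<n (xs<n ∘ there) i

module Colouring {τ : Signature} (ar : IsArithmetic τ) (S : Structure τ)
                 (S-arith : IsArithmeticStructure ar S) (k : ℕ) .{{k≢0 : NonZero k}} where

  open Ranks ar S S-arith public
  open Separation k

  Basic : Scheme → (p q : Universe) → Universe → ℕ → Set
  Basic byNumeral     p q v c = v ≡ numeralValue c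
  Basic (byResidue a) p q v c = Congruent (a * k + c) p q v

  Colour : Scheme → (p q : Universe) → Universe → ℕ → Set
  Colour Θ p q v = First (Basic Θ p q v)

  record Perfect (Θ : Scheme) (p q : Universe) (W : List Universe) : Set where
    field
      coloured : ∀ {w} → w ∈ W → Σ[ c ∈ ℕ ] c < palette k Θ × Colour Θ p q w c
      distinct : ∀ {c w w'} → w ∈ W → w' ∈ W → Colour Θ p q w c → Colour Θ p q w' c → w ≡ w'

  perfect-byNumeral : ∀ {W} → size < threshold → ∀ p q → Perfect byNumeral p q W
  perfect-byNumeral size<threshold p q = record
    { coloured = λ {w} _ → first threshold (λ c _ → w Fin.≟ numeralValue c) (rk w)
        (<-trans (rk<size w) size<threshold) (rk-injective (sym (rk-numeral (rk<size w))))
    ; distinct = λ _ _ (_ , w≡) (_ , w'≡) → trans w≡ (sym w'≡)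
    }

  module ByResidue {W : List Universe} (∣W∣≤k : length W ≤ k) (threshold≤size : threshold ≤ size) where

    ranks : ℕ → ℕ
    ranks = nth (map rk W)

    ranks<size : ∀ i → ranks i < size
    ranks<size = nth< (map rk W) (≤-<-trans z≤n (rk<size ⟦ zero′ ⟧ᶜ)) mapped
      where
      mapped : ∀ {x} → x ∈ map rk W → x < size
      mapped x∈ with y , _ , refl ← ∈-map⁻ rk x∈ = rk<size y

    index : ∀ {w} → w ∈ W → Σ[ i ∈ ℕ ] i < k × ranks i ≡ rk w
    index w∈W with i , i< , eq ← ∈⇒nth (∈-map⁺ rk w∈W) =
      i , <-≤-trans i< (≤-trans (≤-reflexive (length-map rk W)) ∣W∣≤k) , eq

    module _ (a : ℕ) (p q : Universe) (p>0 : 0 < rk p)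
             (m< : ∀ i → i < k → modulus (rk p) (a * k + i) < size)
             (q%≡ : ∀ i → i < k → rk q % modulus (rk p) (a * k + i) ≡ ranks i % modulus (rk p) (a * k + i))
             (separated : ∀ i l → i < k → l < k →
               ranks l % modulus (rk p) (a * k + i) ≡ ranks i % modulus (rk p) (a * k + i) → ranks l ≡ ranks i)
             where

      coloured : ∀ {w} → w ∈ W → Σ[ c ∈ ℕ ] c < k × Colour (byResidue a) p q w c
      coloured {w} w∈W with i , i<k , eq ← index w∈W =
        first k
          (λ c c<k → map′ (%⇒congruent (a * k + c) p>0 (m< c c<k))
                          (congruent⇒% (a * k + c) p>0 (m< c c<k)) (_ ≟ _))
          i i<k (%⇒congruent (a * k + i) p>0 (m< i i<k)
                  (trans (cong (_% modulus (rk p) (a * k + i)) (sym eq)) (sym (q%≡ i i<k))))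

      -- Colour c says that w ≡ q modulo the modulus of c, and q ≡ `ranks c` by the choice of q;
      -- separation turns this congruence into an equality. Hence elements of W of the same colour
      -- coincide.
      determined : ∀ {c w} → w ∈ W → Colour (byResidue a) p q w c → rk w ≡ ranks c
      determined {c} {w} w∈W w-c =
        trans (sym l≡) (separated c l c<k l<k
          (trans (cong (_% modulus (rk p) (a * k + c)) l≡)
            (trans (congruent⇒% (a * k + c) p>0 (m< c c<k) (proj₂ w-c)) (q%≡ c c<k))))
        where
        c<k : c < k
        c<k = let d , d<k , w-d = coloured w∈W in subst (_< k) (first-unique w-d w-c) d<k
        l : ℕ
        l = proj₁ (index w∈W)
        l<k : l < k
        l<k = proj₁ (proj₂ (index w∈W))
        l≡ : ranks l ≡ rk w
        l≡ = proj₂ (proj₂ (index w∈W))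

      perfect-byResidue : Perfect (byResidue a) p q W
      perfect-byResidue = record
        { coloured = coloured
        ; distinct = λ w∈W w'∈W w-c w'-c → rk-injective
            (trans (determined w∈W w-c) (sym (determined w'∈W w'-c)))
        }

    perfect-scheme : Σ[ a ∈ ℕ ] a < blocks × Σ[ p ∈ Universe ] Σ[ q ∈ Universe ] Perfect (byResidue a) p q W
    perfect-scheme
      with separate size threshold≤size ranks ranks<size
    ... | record { block = a ; multiplier = p ; remainder = q ; block< = block< ; remainder< = q<size
                 ; multiplier>0 = p>0 ; modulus< = m< ; congruent = q%≡ ; separated = separated }
      -- As k is nonzero there is a first modulus; it exceeds p and lies below `size`, so p is the
      -- rank of an element.
      with p' , refl ← rk-surjective (<-trans (s≤s (m≤m+n p _)) (m< 0 (>-nonZero⁻¹ k)))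
      with q' , refl ← rk-surjective q<size
      = a , block< , p' , q' , perfect-byResidue a p' q' p>0 m< q%≡ separated

  perfect : ∀ W → length W ≤ k → Σ[ Θ ∈ Scheme ] Θ ∈ schemes k ×
            Σ[ p ∈ Universe ] Σ[ q ∈ Universe ] Perfect Θ p q W
  perfect W ∣W∣≤k with size <? threshold
  ... | yes lt = byNumeral , here refl , ⟦ zero′ ⟧ᶜ , ⟦ zero′ ⟧ᶜ , perfect-byNumeral lt _ _
  ... | no  ≮  with a , a< , pq ← ByResidue.perfect-scheme ∣W∣≤k (≮⇒≥ ≮) =
    byResidue a , there (∈-map⁺ byResidue (∈-upTo⁺ a<)) , pq

-- The translation

module _ {A : Set} where

  _[_≔_] : (Variable → A) → Variable → A → Variable → A
  (f [ x ≔ a ]) y = if ⌊ y ≟ x ⌋ then a else f y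

  ≔-same : ∀ (f : Variable → A) x {a} → (f [ x ≔ a ]) x ≡ a
  ≔-same f x with x ≟ x
  ... | yes _   = refl
  ... | no  x≢x = contradiction refl x≢x

  ≔-other : ∀ (f : Variable → A) {x a y} → y ≢ x → (f [ x ≔ a ]) y ≡ f y
  ≔-other f {x} {a} {y} y≢x with y ≟ x
  ... | yes y≡x = contradiction y≡x y≢x
  ... | no  _   = refl

module _ {τ : Signature} where

  data Literal : Formula τ → Set where
    pos : ∀ {φ} → IsAtom φ → Literal φ
    neg : ∀ {φ} → IsAtom φ → Literal (~ φ)

  -- `IsNNF` refined by what the translation consults: all names are below F, inequalities between
  -- variables are set apart, and any other literal has all its free variables in the core and not
  -- too many occurrences of them.
  data NNF (F : ℕ) : Formula τ → Set where
    literal : ∀ {φ} → Literal φ → (∀ {y} → y ∈ free φ → y < F) → core φ ≡ free φ →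
              length (free φ) ≤ 2 ⊔ arity τ → NNF F φ
    unequal : ∀ {x y} → x < F → y < F → NNF F (~ (var x ≐ var y))
    _∧_     : ∀ {φ ψ} → NNF F φ → NNF F ψ → NNF F (φ ∧ ψ)
    _∨_     : ∀ {φ ψ} → NNF F φ → NNF F ψ → NNF F (φ ∨ ψ)
    forAll  : ∀ {d φ} → d < F → NNF F φ → NNF F (forAll d φ)
    exists  : ∀ {x φ} → x < F → NNF F φ → NNF F (exists x φ)

  ∈-remove⁺ : ∀ {x y xs} → y ≢ x → y ∈ xs → y ∈ remove {τ} x xs
  ∈-remove⁺ {x} y≢x y∈xs = ∈-filter⁺ (λ y → ¬? (y ≟ x)) y∈xs y≢x

  ∈-remove⁻ : ∀ {x y xs} → y ∈ remove {τ} x xs → y ∈ xs × y ≢ x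
  ∈-remove⁻ {x} = ∈-filter⁻ (λ y → ¬? (y ≟ x))

  free<F : ∀ {F φ} → NNF F φ → ∀ {y} → y ∈ free φ → y < F
  free<F (literal L fr _ _) y∈ = fr y∈
  free<F (unequal x<F y<F) (here refl) = x<F
  free<F (unequal x<F y<F) (there (here refl)) = y<F
  free<F (_∧_ {φ} m n) y∈ with ∈-++⁻ (free φ) y∈
  ... | inj₁ y∈ˡ = free<F m y∈ˡ
  ... | inj₂ y∈ʳ = free<F n y∈ʳ
  free<F (_∨_ {φ} m n) y∈ with ∈-++⁻ (free φ) y∈
  ... | inj₁ y∈ˡ = free<F m y∈ˡ
  ... | inj₂ y∈ʳ = free<F n y∈ʳ
  free<F (forAll {d} {φ} _ n) y∈ = free<F n (proj₁ (∈-remove⁻ {xs = free φ} y∈))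
  free<F (exists {d} {φ} _ n) y∈ = free<F n (proj₁ (∈-remove⁻ {xs = free φ} y∈))

  -- Quantifiers below universal ones are counted too, so that a single k is large enough for every
  -- block.
  existentials : ∀ {F φ} → NNF F φ → ℕ
  existentials (literal _ _ _ _) = 0
  existentials (unequal _ _)     = 0
  existentials (m ∧ n)           = existentials m + existentials n
  existentials (m ∨ n)           = existentials m + existentials n
  existentials (forAll _ n)      = existentials n
  existentials (exists _ n)      = suc (existentials n)

  renameTerm : (Variable → Variable) → Term τ → Term τ
  renameTerm r (var x)   = var (r x)
  renameTerm r (const c) = const c
  renameTerm r (app f t) = app f (renameTerm r t)

  renameAtom : ∀ {φ} → (Variable → Variable) → IsAtom φ → Formula τ
  renameAtom r (rel R ts) = rel R (vmap (renameTerm r) ts)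
  renameAtom r (s ≐ t)    = renameTerm r s ≐ renameTerm r t

  rename : ∀ {φ} → (Variable → Variable) → Literal φ → Formula τ
  rename r (pos A) = renameAtom r A
  rename r (neg A) = ~ renameAtom r A

-- The colours of the weakly quantified variables in scope; all others map to nothing.
Environment : Set
Environment = Variable → Maybe ℕ

∅ : Environment
∅ _ = nothing

-- Names from F on do not occur in the given formula: the parameters of the
-- current colouring, three auxiliary variables, and the variables for the
-- weakly quantified arguments of a literal.
module Translation {τ : Signature} (ar : IsArithmetic τ) (F k : ℕ) .{{k≢0 : NonZero k}} where

  open IsArithmetic ar renaming (zero to zero′; succ to succ′)

  p q t u s : Variable
  p = F + 0
  q = F + 1
  t = F + 2
  u = F + 3
  s = F + 4

  w : ℕ → Variable
  w i = F + (5 + i)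

  numeral : ℕ → Term τ
  numeral zero    = const zero′
  numeral (suc c) = app succ′ (numeral c)

  ⊤′ ⊥′ : Formula τ
  ⊤′ = const zero′ ≐ const zero′
  ⊥′ = ~ ⊤′

  ⋁ : List (Formula τ) → Formula τ
  ⋁ []       = ⊥′
  ⋁ (φ ∷ φs) = φ ∨ ⋁ φs

  matrix : ℕ → Variable → Formula τ
  matrix j v =
    rel mult (numeral (suc j) ∷ var p ∷ var t ∷ []) ∧
    rel mult (app succ′ (var t) ∷ var u ∷ var s ∷ []) ∧
    (rel add (var s ∷ var q ∷ var v ∷ []) ∨ rel add (var s ∷ var v ∷ var q ∷ []))

  basic : Scheme → Variable → ℕ → Formula τ
  basic byNumeral     v c = var v ≐ numeral c
  basic (byResidue a) v c = exists t (exists u (exists s (matrix (a * k + c) v)))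

  none-below : Scheme → Variable → ℕ → Formula τ
  none-below Θ v zero    = ⊤′
  none-below Θ v (suc c) = none-below Θ v c ∧ ~ basic Θ v c

  colour : Scheme → Variable → ℕ → Formula τ
  colour Θ v c = none-below Θ v c ∧ basic Θ v c

  -- The list runs over occurrences, so a coloured variable may be quantified several times. The
  -- last renaming wins, and the earlier quantifiers merely assert once more that the colour is
  -- inhabited.
  close : Scheme → Environment → ∀ {φ} → Literal φ → ℕ → (Variable → Variable) → List Variable → Formula τ
  close Θ η L i r []       = rename r L
  close Θ η L i r (x ∷ xs) with η x
  ... | nothing = close Θ η L i r xs
  ... | just c  = exists (w i) (colour Θ (w i) c ∧ close Θ η L (suc i) (r [ x ≔ w i ]) xs)

  apart : Scheme → (x y : Variable) → Maybe ℕ → Maybe ℕ → Formula τ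
  apart Θ x y (just c) (just d) = if ⌊ c ≟ d ⌋ then ⊥′ else ⊤′
  apart Θ x y (just c) nothing  = ~ colour Θ y c
  apart Θ x y nothing  (just d) = ~ colour Θ x d
  apart Θ x y nothing  nothing  = ~ (var x ≐ var y)

  translate : ∀ {φ} → Scheme → Environment → NNF F φ → Formula τ

  block : ∀ {φ} → NNF F φ → Formula τ
  block n = ⋁ (map (λ Ξ → exists p (exists q (translate Ξ ∅ n))) (schemes k))

  translate {φ} Θ η (literal L _ _ _)     = close Θ η L 0 id (free φ)
  translate Θ η (unequal {x} {y} _ _)     = apart Θ x y (η x) (η y)
  translate Θ η (m ∧ n)                   = translate Θ η m ∧ translate Θ η n
  translate Θ η (m ∨ n)                   = translate Θ η m ∨ translate Θ η n
  translate Θ η (forAll {d} _ n)          = forAll d (block n)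
  translate Θ η (exists {x} {φ} _ n)      =
    if ⌊ strong? x φ ⌋
    then exists x (translate Θ (η [ x ≔ nothing ]) n)
    -- The first conjunct says that colour c is inhabited. It supplies a witness for x where no
    -- literal does, for instance when x occurs only in inequalities.
    else ⋁ (map (λ c → exists (w 0) (colour Θ (w 0) c) ∧ translate Θ (η [ x ≔ just c ]) n)
                (upTo (palette k Θ)))

-- Correctness

Weak : ∀ {τ} → Environment → Formula τ → Set
Weak η φ = ∀ {y c} → η y ≡ just c → ¬ Strong y φ

module _ {τ : Signature} {η : Environment} where

  weak-∧ˡ : ∀ {α β : Formula τ} → Weak η (α ∧ β) → Weak η α
  weak-∧ˡ weak {y} ηy = weak {y} ηy ∘ Sum.map (there ∘ ++⁺ˡ) (there ∘ ++⁺ˡ)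

  weak-∧ʳ : ∀ {α β : Formula τ} → Weak η (α ∧ β) → Weak η β
  weak-∧ʳ {α} weak {y} ηy = weak {y} ηy ∘
    Sum.map (there ∘ ++⁺ʳ (subformulas y α)) (there ∘ ++⁺ʳ (subformulas y α))

  weak-∨ˡ : ∀ {α β : Formula τ} → Weak η (α ∨ β) → Weak η α
  weak-∨ˡ weak {y} ηy = weak {y} ηy ∘ Sum.map (there ∘ ++⁺ˡ) (there ∘ ++⁺ˡ)

  weak-∨ʳ : ∀ {α β : Formula τ} → Weak η (α ∨ β) → Weak η β
  weak-∨ʳ {α} weak {y} ηy = weak {y} ηy ∘
    Sum.map (there ∘ ++⁺ʳ (subformulas y α)) (there ∘ ++⁺ʳ (subformulas y α))

  weak-exists : ∀ {x m} {φ : Formula τ} → Weak η (exists x φ) →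
                (∀ {c} → m ≡ just c → ¬ Strong x φ) → Weak (η [ x ≔ m ]) φ
  weak-exists {x} {m} {φ} weak weak-x {y} ηy with y ≟ x
  ... | yes refl = weak-x ηy
  ... | no  y≢x  = weak {y} ηy ∘ Sum.map (enter (DependentUniversal y)) (enter (SplitConjunction y))
    where
    enter : ∀ (P : Formula τ → Set) → Any P (subformulas y φ) → Any P (subformulas y (exists x φ))
    enter P i with x ≟ y
    ... | yes x≡y = contradiction (sym x≡y) y≢x
    ... | no  _   = there i

  -- If a coloured y were free in `forAll d φ`, then d would depend on y and the quantifier of y
  -- would be strong. This is why the block below a universal quantifier can start from the empty
  -- environment.
  weak-forAll : ∀ {d} {φ : Formula τ} → Weak η (forAll d φ) →
                ∀ {y} → y ∈ free φ → y ≢ d → η y ≡ nothing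
  weak-forAll {d} {φ} weak {y} y∈ y≢d with η y in ηy
  ... | nothing = refl
  ... | just c  = contradiction (inj₁ (here (∈-remove⁺ {τ} y≢d y∈))) (weak {y} ηy)

  weak-split : ∀ {α β : Formula τ} → Weak η (α ∧ β) →
               ∀ {y c} → η y ≡ just c → y ∈ core α → y ∉ core β
  weak-split weak {y} ηy y∈α y∈β = weak {y} ηy (inj₂ (here (y∈α , y∈β)))

module Satisfaction {τ : Signature} (S : Structure τ) where
  open Structure S
  open Semantics S

  eval-rename : ∀ {ρ σ} r (t : Term τ) → (∀ {y} → y ∈ termVars t → ρ (r y) ≡ σ y) →
                eval ρ (renameTerm r t) ≡ eval σ t
  eval-rename r (var x)   eq = eq (here refl)
  eval-rename r (const c) eq = refl
  eval-rename r (app f t) eq = cong ⟦ f ⟧ᶠ (eval-rename r t eq)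

  evals-rename : ∀ {ρ σ n} r (ts : Vec (Term τ) n) → (∀ {y} → y ∈ vecVars ts → ρ (r y) ≡ σ y) →
                 vmap (eval ρ) (vmap (renameTerm r) ts) ≡ vmap (eval σ) ts
  evals-rename r []       eq = refl
  evals-rename r (t ∷ ts) eq = cong₂ _∷_
    (eval-rename r t (eq ∘ ∈-++⁺ˡ)) (evals-rename r ts (eq ∘ ∈-++⁺ʳ (termVars t)))

  atom-rename : ∀ {ρ σ φ} r (A : IsAtom φ) → (∀ {y} → y ∈ free φ → ρ (r y) ≡ σ y) →
                (ρ ⊨ renameAtom r A) ⇔ (σ ⊨ φ)
  atom-rename r (rel R ts) eq = mk⇔ (subst (T ∘ ⟦ R ⟧ʳ) vs) (subst (T ∘ ⟦ R ⟧ʳ) (sym vs))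
    where vs = evals-rename r ts eq
  atom-rename r (s₁ ≐ s₂) eq = mk⇔ (λ e → trans (sym e₁) (trans e e₂)) (λ e → trans e₁ (trans e (sym e₂)))
    where
    e₁ = eval-rename r s₁ (eq ∘ ∈-++⁺ˡ)
    e₂ = eval-rename r s₂ (eq ∘ ∈-++⁺ʳ (termVars s₁))

  literal-rename : ∀ {ρ σ φ} r (L : Literal φ) → (∀ {y} → y ∈ free φ → ρ (r y) ≡ σ y) →
                   (ρ ⊨ rename r L) ⇔ (σ ⊨ φ)
  literal-rename r (pos A) eq = atom-rename r A eq
  literal-rename r (neg A) eq = mk⇔ (_∘ from A⇔) (_∘ to A⇔)
    where A⇔ = atom-rename r A eq

  literal-cong : ∀ {ρ σ φ} (L : Literal φ) → (∀ {y} → y ∈ free φ → ρ y ≡ σ y) → ρ ⊨ φ → σ ⊨ φ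
  literal-cong {ρ} {σ} L eq ρ⊨φ =
    to (literal-rename {ρ = ρ} {σ} id L eq) (from (literal-rename {ρ = ρ} {ρ} id L (λ _ → refl)) ρ⊨φ)

module Correctness {τ : Signature} (ar : IsArithmetic τ) (F k : ℕ) .{{k≢0 : NonZero k}}
                   (S : Structure τ) (S-arith : IsArithmeticStructure ar S) where

  open Translation ar F k
  open Colouring ar S S-arith k hiding (mult; add; lt; zero′; succ′; add≢mult)
  open Semantics S
  open Satisfaction S

  reserved-≢ : ∀ {i j} → i ≢ j → F + i ≢ F + j
  reserved-≢ i≢j = i≢j ∘ +-cancelˡ-≡ F _ _

  <⇒≢reserved : ∀ {y} i → y < F → y ≢ F + i
  <⇒≢reserved i y<F refl = contradiction y<F (≤⇒≯ (m≤m+n F i))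

  Fresh : Variable → Set
  Fresh v = ∀ {i} → i < 5 → v ≢ F + i

  fresh-< : ∀ {y} → y < F → Fresh y
  fresh-< y<F {i} _ = <⇒≢reserved i y<F

  fresh-w : ∀ i → Fresh (w i)
  fresh-w i j<5 = reserved-≢ (λ eq → contradiction j<5 (≤⇒≯ (subst (5 ≤_) eq (m≤m+n 5 i))))

  eval-numeral : ∀ ρ c → eval ρ (numeral c) ≡ numeralValue c
  eval-numeral ρ zero    = refl
  eval-numeral ρ (suc c) = cong ⟦ _ ⟧ᶠ (eval-numeral ρ c)

  matrix-sat : ∀ ρ j v → (ρ ⊨ matrix j v) ⇔ Matrix j (ρ p) (ρ q) (ρ t) (ρ u) (ρ s) (ρ v)
  matrix-sat ρ j v rewrite eval-numeral ρ j = mk⇔ id id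

  module _ (ρ : Assignment) (v : Variable) (v-fresh : Fresh v) (a b c : Universe) where

    private
      ρ′ : Assignment
      ρ′ = ((ρ [ t ↦ a ]) [ u ↦ b ]) [ s ↦ c ]

      outside : ∀ {y} → y ≢ t → y ≢ u → y ≢ s → ρ′ y ≡ ρ y
      outside y≢t y≢u y≢s = trans (≔-other ((ρ [ t ↦ a ]) [ u ↦ b ]) y≢s)
        (trans (≔-other (ρ [ t ↦ a ]) y≢u) (≔-other ρ y≢t))

    matrix-update : ∀ j → (ρ′ ⊨ matrix j v) ⇔ Matrix j (ρ p) (ρ q) a b c (ρ v)
    matrix-update j = mk⇔
      (move ρ-p ρ-q ρ-t ρ-u ρ-s ρ-v ∘ to (matrix-sat ρ′ j v))
      (from (matrix-sat ρ′ j v) ∘ move (sym ρ-p) (sym ρ-q) (sym ρ-t) (sym ρ-u) (sym ρ-s) (sym ρ-v))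
      where
      move : ∀ {p q t u s v p′ q′ t′ u′ s′ v′} → p ≡ p′ → q ≡ q′ → t ≡ t′ → u ≡ u′ → s ≡ s′ → v ≡ v′ →
             Matrix j p q t u s v → Matrix j p′ q′ t′ u′ s′ v′
      move refl refl refl refl refl refl = id
      ρ-p = outside {p} (reserved-≢ λ ()) (reserved-≢ λ ()) (reserved-≢ λ ())
      ρ-q = outside {q} (reserved-≢ λ ()) (reserved-≢ λ ()) (reserved-≢ λ ())
      ρ-t : ρ′ t ≡ a
      ρ-t = trans (≔-other ((ρ [ t ↦ a ]) [ u ↦ b ]) (reserved-≢ λ ()))
              (trans (≔-other (ρ [ t ↦ a ]) (reserved-≢ λ ())) (≔-same ρ t))
      ρ-u : ρ′ u ≡ b
      ρ-u = trans (≔-other ((ρ [ t ↦ a ]) [ u ↦ b ]) (reserved-≢ λ ())) (≔-same (ρ [ t ↦ a ]) u)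
      ρ-s : ρ′ s ≡ c
      ρ-s = ≔-same ((ρ [ t ↦ a ]) [ u ↦ b ]) s
      ρ-v = outside {v} (v-fresh (s≤s (s≤s (s≤s z≤n)))) (v-fresh (s≤s (s≤s (s≤s (s≤s z≤n))))) (v-fresh ≤-refl)

  basic-sat : ∀ Θ ρ v → Fresh v → ∀ c → (ρ ⊨ basic Θ v c) ⇔ Basic Θ (ρ p) (ρ q) (ρ v) c
  basic-sat byNumeral     ρ v v-fresh c rewrite eval-numeral ρ c = mk⇔ id id
  basic-sat (byResidue a) ρ v v-fresh c = mk⇔
    (λ (x , y , z , h) → x , y , z , to (matrix-update ρ v v-fresh x y z (a * k + c)) h)
    (λ (x , y , z , h) → x , y , z , from (matrix-update ρ v v-fresh x y z (a * k + c)) h)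

  none-below-sat : ∀ Θ ρ v → Fresh v → ∀ c →
                   (ρ ⊨ none-below Θ v c) ⇔ (∀ {d} → d < c → ¬ Basic Θ (ρ p) (ρ q) (ρ v) d)
  none-below-sat Θ ρ v v-fresh zero    = mk⇔ (λ _ ()) (λ _ → refl)
  none-below-sat Θ ρ v v-fresh (suc c) = mk⇔ forwards backwards
    where
    forwards : ρ ⊨ none-below Θ v (suc c) → ∀ {d} → d < suc c → ¬ Basic Θ (ρ p) (ρ q) (ρ v) d
    forwards (below , ¬c) d<1+c with m≤n⇒m<n∨m≡n (s≤s⁻¹ d<1+c)
    ... | inj₁ d<c  = to (none-below-sat Θ ρ v v-fresh c) below d<c
    ... | inj₂ refl = ¬c ∘ from (basic-sat Θ ρ v v-fresh c)
    backwards : (∀ {d} → d < suc c → ¬ Basic Θ (ρ p) (ρ q) (ρ v) d) → ρ ⊨ none-below Θ v (suc c)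
    backwards none = from (none-below-sat Θ ρ v v-fresh c) (none ∘ m<n⇒m<1+n)
                   , none ≤-refl ∘ to (basic-sat Θ ρ v v-fresh c)

  colour-sat : ∀ Θ ρ v → Fresh v → ∀ c → (ρ ⊨ colour Θ v c) ⇔ Colour Θ (ρ p) (ρ q) (ρ v) c
  colour-sat Θ ρ v v-fresh c = mk⇔
    (λ (below , b) → to (none-below-sat Θ ρ v v-fresh c) below , to (basic-sat Θ ρ v v-fresh c) b)
    (λ (below , b) → from (none-below-sat Θ ρ v v-fresh c) below , from (basic-sat Θ ρ v v-fresh c) b)

  ⋁-sat : ∀ {A : Set} ρ (f : A → Formula τ) xs → (ρ ⊨ ⋁ (map f xs)) ⇔ (Σ[ x ∈ A ] x ∈ xs × ρ ⊨ f x)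
  ⋁-sat ρ f []       = mk⇔ (λ ¬⊤ → ⊥-elim (¬⊤ refl)) (λ ())
  ⋁-sat {A} ρ f (x ∷ xs) = mk⇔ forwards backwards
    where
    forwards : ρ ⊨ ⋁ (map f (x ∷ xs)) → Σ[ x′ ∈ A ] x′ ∈ x ∷ xs × ρ ⊨ f x′
    forwards (inj₁ h) = x , here refl , h
    forwards (inj₂ h) with y , y∈ , hy ← to (⋁-sat ρ f xs) h = y , there y∈ , hy
    backwards : (Σ[ x′ ∈ A ] x′ ∈ x ∷ xs × ρ ⊨ f x′) → ρ ⊨ ⋁ (map f (x ∷ xs))
    backwards (y , here refl , h) = inj₁ h
    backwards (y , there y∈ , h)  = inj₂ (from (⋁-sat ρ f xs) (y , y∈ , h))

  module _ (Θ : Scheme) (P Q : Universe) where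

    record Current (ρ : Assignment) : Set where
      constructor current
      field
        p≡ : ρ p ≡ P
        q≡ : ρ q ≡ Q

    open Current

    current-update : ∀ {ρ x a} → x ≢ p → x ≢ q → Current ρ → Current (ρ [ x ↦ a ])
    current-update {ρ} x≢p x≢q (current p≡ q≡) =
      current (trans (≔-other ρ (x≢p ∘ sym)) p≡) (trans (≔-other ρ (x≢q ∘ sym)) q≡)

    colour-at : ∀ {ρ v} → Current ρ → Fresh v → ∀ c → (ρ ⊨ colour Θ v c) ⇔ Colour Θ P Q (ρ v) c
    colour-at {ρ} {v} (current refl refl) v-fresh = colour-sat Θ ρ v v-fresh

    w-current : ∀ {ρ a} i → Current ρ → Current (ρ [ w i ↦ a ])
    w-current i = current-update (reserved-≢ λ ()) (reserved-≢ λ ())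

    colour-w : ∀ {ρ a} i → Current ρ → ∀ c → (ρ [ w i ↦ a ] ⊨ colour Θ (w i) c) ⇔ Colour Θ P Q a c
    colour-w {ρ} {a} i cur c = subst (λ a′ → (ρ [ w i ↦ a ] ⊨ colour Θ (w i) c) ⇔ Colour Θ P Q a′ c) (≔-same ρ (w i))
      (colour-at (w-current i cur) (fresh-w i) c)

    Coloured : Environment → Assignment → Set
    Coloured η σ = ∀ {y c} → η y ≡ just c → Colour Θ P Q (σ y) c

    module _ (η : Environment) {φ : Formula τ} (L : Literal φ) where

      -- Keeps the names in use below the next `w i`, so that assigning to `w i` disturbs no value
      -- chosen before.
      InRange : ℕ → (Variable → Variable) → Set
      InRange i r = ∀ {y} → y ∈ free φ → r y < w i

      inRange-update : ∀ {i r} x → InRange i r → InRange (suc i) (r [ x ≔ w i ])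
      inRange-update {i} {r} x r< {y} y∈ with y ≟ x
      ... | yes _ = ≤-reflexive (sym (trans (cong (F +_) (+-suc 5 i)) (+-suc F (5 + i))))
      ... | no  _ = <-trans (r< y∈) (≤-reflexive (sym (trans (cong (F +_) (+-suc 5 i)) (+-suc F (5 + i)))))

      close-sound : ∀ xs i r {ρ} → Current ρ → InRange i r → ρ ⊨ close Θ η L i r xs →
        Σ[ σ ∈ Assignment ] σ ⊨ φ ×
          (∀ {y} → y ∈ free φ → y ∉ xs ⊎ η y ≡ nothing → σ y ≡ ρ (r y)) ×
          (∀ {y c} → y ∈ free φ → y ∈ xs → η y ≡ just c → Colour Θ P Q (σ y) c)
      close-sound [] i r {ρ} cur r< h =
        ρ ∘ r , to (literal-rename {σ = ρ ∘ r} r L (λ _ → refl)) h , (λ _ _ → refl) , λ _ ()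
      close-sound (x ∷ xs) i r {ρ} cur r< h with η x in ηx
      ... | nothing with σ , σ⊨φ , same , col ← close-sound xs i r cur r< h =
        σ , σ⊨φ , (λ y∈ → same y∈ ∘ Sum.map₁ (_∘ there))
          , λ { y∈φ (here refl) ηy → contradiction (trans (sym ηx) ηy) λ ()
              ; y∈φ (there y∈) ηy → col y∈φ y∈ ηy }
      ... | just c with a , a-col , h′ ← h
                   with σ , σ⊨φ , same , col ←
                          close-sound xs (suc i) (r [ x ≔ w i ]) (w-current i cur) (inRange-update x r<) h′ =
        σ , σ⊨φ , same′ , col′
        where
        same′ : ∀ {y} → y ∈ free φ → y ∉ x ∷ xs ⊎ η y ≡ nothing → σ y ≡ ρ (r y)
        same′ {y} y∈ cond = trans (same y∈ (Sum.map₁ (_∘ there) cond))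
          (trans (cong (ρ [ w i ↦ a ]) (≔-other r y≢x)) (≔-other ρ (<⇒≢ (r< y∈))))
          where
          y≢x : y ≢ x
          y≢x refl = Sum.[ (λ y∉ → y∉ (here refl)) , (λ ηy → contradiction (trans (sym ηx) ηy) λ ()) ] cond
        col′ : ∀ {y d} → y ∈ free φ → y ∈ x ∷ xs → η y ≡ just d → Colour Θ P Q (σ y) d
        col′ y∈φ (there y∈) ηy = col y∈φ y∈ ηy
        col′ {y} y∈φ (here refl) ηy with y ∈? xs
        ... | yes y∈ = col y∈φ y∈ ηy
        ... | no  y∉ = subst₂ (Colour Θ P Q)
          (sym (trans (same y∈φ (inj₁ y∉)) (trans (cong (ρ [ w i ↦ a ]) (≔-same r y)) (≔-same ρ (w i)))))
          (just-injective (trans (sym ηx) ηy)) (to (colour-w i cur c) a-col)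

      close-complete : ∀ xs i r {ρ σ} → Current ρ → InRange i r → σ ⊨ φ →
        (∀ {y} → y ∈ free φ → ρ (r y) ≡ σ y ⊎ (y ∈ xs × Σ[ c ∈ ℕ ] η y ≡ just c)) →
        (∀ {y c} → y ∈ xs → η y ≡ just c → Colour Θ P Q (σ y) c) →
        ρ ⊨ close Θ η L i r xs
      close-complete [] i r {ρ} {σ} cur r< σ⊨φ agree col = from (literal-rename r L same) σ⊨φ
        where
        same : ∀ {y} → y ∈ free φ → ρ (r y) ≡ σ y
        same y∈ with agree y∈
        ... | inj₁ eq = eq
        ... | inj₂ (() , _)
      close-complete (x ∷ xs) i r {ρ} {σ} cur r< σ⊨φ agree col with η x in ηx
      ... | nothing = close-complete xs i r cur r< σ⊨φ agree′ (col ∘ there)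
        where
        agree′ : ∀ {y} → y ∈ free φ → ρ (r y) ≡ σ y ⊎ (y ∈ xs × Σ[ c ∈ ℕ ] η y ≡ just c)
        agree′ y∈ with agree y∈
        ... | inj₁ eq = inj₁ eq
        ... | inj₂ (here refl , c , ηy) = contradiction (trans (sym ηx) ηy) λ ()
        ... | inj₂ (there y∈ , ηy) = inj₂ (y∈ , ηy)
      ... | just c =
        σ x , from (colour-w i cur c) (col (here refl) ηx)
            , close-complete xs (suc i) (r [ x ≔ w i ]) (w-current i cur) (inRange-update x r<) σ⊨φ agree′ (col ∘ there)
        where
        agree′ : ∀ {y} → y ∈ free φ →
                 (ρ [ w i ↦ σ x ]) ((r [ x ≔ w i ]) y) ≡ σ y ⊎ (y ∈ xs × Σ[ c ∈ ℕ ] η y ≡ just c)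
        agree′ {y} y∈ with y ≟ x
        ... | yes refl = inj₁ (≔-same ρ (w i))
        ... | no  y≢x with agree y∈
        ...   | inj₁ eq = inj₁ (trans (≔-other ρ (<⇒≢ (r< y∈))) eq)
        ...   | inj₂ (here y≡x , _) = contradiction y≡x y≢x
        ...   | inj₂ (there y∈ , ηy) = inj₂ (y∈ , ηy)

  -- Here σ is the assignment read off from the translation and σ′ any assignment that ought to
  -- satisfy φ. A coloured variable outside the core may take any element of its colour in σ′, which
  -- is the freedom that merging two sides of a conjunction uses.
  record Compatible (Θ : Scheme) (P Q : Universe) (φ : Formula τ) (η : Environment)
                    (ρ σ σ′ : Assignment) : Set where
    constructor compatible
    field
      outer    : ∀ {y} → y ∈ free φ → η y ≡ nothing → σ′ y ≡ ρ y
      coloured : ∀ {y c} → y ∈ free φ → η y ≡ just c → Colour Θ P Q (σ′ y) c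
      chosen   : ∀ {y c} → y ∈ core φ → η y ≡ just c → σ′ y ≡ σ y

  open Compatible

  compatible-⊆ : ∀ {Θ P Q φ ψ η ρ σ₁ σ₂ σ′} → (∀ {y} → y ∈ free ψ → y ∈ free φ) →
    (∀ {y} → y ∈ core ψ → y ∈ core φ) →
    (∀ {y c} → y ∈ core ψ → η y ≡ just c → σ₁ y ≡ σ₂ y) →
    Compatible Θ P Q φ η ρ σ₁ σ′ → Compatible Θ P Q ψ η ρ σ₂ σ′
  compatible-⊆ free⊆ core⊆ σ₁≡σ₂ (compatible out col cho) = compatible
    (out ∘ free⊆) (col ∘ free⊆) (λ y∈ ηy → trans (cho (core⊆ y∈) ηy) (σ₁≡σ₂ y∈ ηy))

  -- Serves both kinds of quantifier: for a strong one m is `nothing` and the value a comes from ρ′,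
  -- for a weak one m is a colour and a comes from σ. The value b is arbitrary because x is not in
  -- the core of `exists x φ`.
  compatible-binder : ∀ {Θ P Q x φ m η ρ ρ′ σ b a σ′} →
    (∀ {y} → y ≢ x → ρ′ y ≡ ρ y) → (m ≡ nothing → a ≡ ρ′ x) →
    (∀ {c} → m ≡ just c → Colour Θ P Q a c × a ≡ σ x) →
    Compatible Θ P Q (exists x φ) η ρ (σ [ x ↦ b ]) σ′ →
    Compatible Θ P Q φ (η [ x ≔ m ]) ρ′ σ (σ′ [ x ↦ a ])
  compatible-binder {Θ} {P} {Q} {x} {φ} {m} {η} {ρ} {ρ′} {σ} {b} {a} {σ′} ρ′≡ρ m≡nothing m≡just
    (compatible out col cho) = compatible outer′ coloured′ chosen′
    where
    outer′ : ∀ {y} → y ∈ free φ → (η [ x ≔ m ]) y ≡ nothing → (σ′ [ x ↦ a ]) y ≡ ρ′ y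
    outer′ {y} y∈ ηy with y ≟ x
    ... | yes refl = m≡nothing ηy
    ... | no  y≢x  = trans (out (∈-remove⁺ {τ} y≢x y∈) ηy) (sym (ρ′≡ρ y≢x))
    coloured′ : ∀ {y c} → y ∈ free φ → (η [ x ≔ m ]) y ≡ just c → Colour Θ P Q ((σ′ [ x ↦ a ]) y) c
    coloured′ {y} y∈ ηy with y ≟ x
    ... | yes refl = proj₁ (m≡just ηy)
    ... | no  y≢x  = col (∈-remove⁺ {τ} y≢x y∈) ηy
    chosen′ : ∀ {y c} → y ∈ core φ → (η [ x ≔ m ]) y ≡ just c → (σ′ [ x ↦ a ]) y ≡ σ y
    chosen′ {y} y∈ ηy with y ≟ x
    ... | yes refl = proj₂ (m≡just ηy)
    ... | no  y≢x  = trans (cho (∈-remove⁺ {τ} y≢x y∈) ηy) (≔-other σ y≢x)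

  p≢q : p ≢ q
  p≢q = reserved-≢ λ ()

  current-parameters : ∀ {Θ P Q} ρ → Current Θ P Q ((ρ [ p ↦ P ]) [ q ↦ Q ])
  current-parameters {Θ} {P} {Q} ρ = current
    (trans (≔-other (ρ [ p ↦ P ]) p≢q) (≔-same ρ p)) (≔-same (ρ [ p ↦ P ]) q)

  parameters-other : ∀ {P Q} ρ {y} → y < F → ((ρ [ p ↦ P ]) [ q ↦ Q ]) y ≡ ρ y
  parameters-other {P} {Q} ρ y<F =
    trans (≔-other (ρ [ p ↦ P ]) (<⇒≢reserved 1 y<F)) (≔-other ρ (<⇒≢reserved 0 y<F))

  coloured-update : ∀ {Θ P Q η σ x m a} → Coloured Θ P Q η σ → (∀ {c} → m ≡ just c → Colour Θ P Q a c) →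
                    Coloured Θ P Q (η [ x ≔ m ]) (σ [ x ↦ a ])
  coloured-update {x = x} col a-col {y} ηy with y ≟ x
  ... | yes _ = a-col ηy
  ... | no  _ = col ηy

  -- The bound x may hide an outer coloured variable of the same name. On leaving the scope, that
  -- variable needs an element b of its own colour again.
  unhide : ∀ {Θ P Q η σ x m} b → Coloured Θ P Q (η [ x ≔ m ]) σ → (∀ {c} → η x ≡ just c → Colour Θ P Q b c) →
           Coloured Θ P Q η (σ [ x ↦ b ])
  unhide {x = x} b col b-col {y} ηy with y ≟ x | col {y}
  ... | yes refl | _    = b-col ηy
  ... | no  _    | col-y = col-y ηy

  -- The witnesses of the weak quantifiers are only determined where they occur in
  -- the core; everywhere else any element of the right colour will do. So the
  -- witnesses that the two sides of a conjunction need can be merged.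
  sound : ∀ {φ : Formula τ} (n : NNF F φ) Θ P Q η ρ δ → Current Θ P Q ρ → Coloured Θ P Q η δ → Weak η φ →
          ρ ⊨ translate Θ η n →
          Σ[ σ ∈ Assignment ] Coloured Θ P Q η σ × (∀ {σ′} → Compatible Θ P Q φ η ρ σ σ′ → σ′ ⊨ φ)

  -- True for all parameters, perfect or not: an element has at most one colour, so a difference in
  -- colour implies a difference of elements.
  apart-sound : ∀ {x y} → x < F → y < F → ∀ Θ P Q η ρ {σ σ′} → Current Θ P Q ρ →
                ρ ⊨ apart Θ x y (η x) (η y) → Compatible Θ P Q (~ (var x ≐ var y)) η ρ σ σ′ → σ′ x ≢ σ′ y
  apart-sound {x} {y} x<F y<F Θ P Q η ρ cur h (compatible out col cho) x≡y with η x in ηx | η y in ηy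
  ... | nothing | nothing = h (trans (sym (out (here refl) ηx)) (trans x≡y (out (there (here refl)) ηy)))
  ... | just c  | nothing = h (from (colour-at Θ P Q cur (fresh-< y<F) c)
        (subst (λ a → Colour Θ P Q a c) (trans x≡y (out (there (here refl)) ηy)) (col (here refl) ηx)))
  ... | nothing | just d  = h (from (colour-at Θ P Q cur (fresh-< x<F) d)
        (subst (λ a → Colour Θ P Q a d) (trans (sym x≡y) (out (here refl) ηx)) (col (there (here refl)) ηy)))
  ... | just c  | just d with c ≟ d
  ...   | yes _   = h refl
  ...   | no  c≢d = c≢d (first-unique (subst (λ a → Colour Θ P Q a c) x≡y (col (here refl) ηx))
                                      (col (there (here refl)) ηy))

  sound {φ} (literal L fr core≡free _) Θ P Q η ρ δ cur δ-col weak h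
    with σ , σ⊨φ , same , col ← close-sound Θ P Q η L (free φ) 0 id cur
           (λ y∈ → <-≤-trans (fr y∈) (m≤m+n F 5)) h =
    σ₁ , σ₁-col , λ {σ′} (compatible out _ cho) → literal-cong {ρ = σ} {σ′} L (agree {σ′} out cho) σ⊨φ
    where
    -- Variables that do not occur in the literal fall back on δ, whose values already have the
    -- right colours.
    σ₁ : Assignment
    σ₁ y = if ⌊ y ∈? free φ ⌋ then σ y else δ y
    σ₁-col : Coloured Θ P Q η σ₁
    σ₁-col {y} ηy with y ∈? free φ
    ... | yes y∈ = col y∈ y∈ ηy
    ... | no  _  = δ-col ηy
    σ₁≡σ : ∀ {y} → y ∈ free φ → σ₁ y ≡ σ y
    σ₁≡σ {y} y∈ with y ∈? free φ
    ... | yes _  = refl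
    ... | no  y∉ = contradiction y∈ y∉
    agree : ∀ {σ′ : Assignment} → (∀ {y} → y ∈ free φ → η y ≡ nothing → σ′ y ≡ ρ y) →
            (∀ {y c} → y ∈ core φ → η y ≡ just c → σ′ y ≡ σ₁ y) → ∀ {y} → y ∈ free φ → σ y ≡ σ′ y
    agree {σ′} out cho {y} y∈ with η y in ηy
    ... | nothing = trans (same y∈ (inj₂ ηy)) (sym (out y∈ ηy))
    ... | just c  = sym (trans (cho (subst (y ∈_) (sym core≡free) y∈) ηy) (σ₁≡σ y∈))
  sound (unequal x<F y<F) Θ P Q η ρ δ cur δ-col weak h =
    δ , δ-col , apart-sound x<F y<F Θ P Q η ρ cur h
  sound (_∧_ {α} {β} m n) Θ P Q η ρ δ cur δ-col weak (hm , hn)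
    with σ₁ , col₁ , ok₁ ← sound m Θ P Q η ρ δ cur δ-col (weak-∧ˡ {β = β} weak) hm
    with σ₂ , col₂ , ok₂ ← sound n Θ P Q η ρ δ cur δ-col (weak-∧ʳ {α = α} weak) hn =
    σ , σ-col , λ compat →
        ok₁ (compatible-⊆ ∈-++⁺ˡ ∈-++⁺ˡ (λ y∈ _ → σ≡σ₁ y∈) compat)
      , ok₂ (compatible-⊆ (∈-++⁺ʳ (free α)) (∈-++⁺ʳ (core α)) σ≡σ₂ compat)
    where
    σ : Assignment
    σ y = if ⌊ y ∈? core α ⌋ then σ₁ y else σ₂ y
    σ-col : Coloured Θ P Q η σ
    σ-col {y} ηy with y ∈? core α
    ... | yes _ = col₁ ηy
    ... | no  _ = col₂ ηy
    σ≡σ₁ : ∀ {y} → y ∈ core α → σ y ≡ σ₁ y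
    σ≡σ₁ {y} y∈ with y ∈? core α
    ... | yes _  = refl
    ... | no  y∉ = contradiction y∈ y∉
    σ≡σ₂ : ∀ {y c} → y ∈ core β → η y ≡ just c → σ y ≡ σ₂ y
    σ≡σ₂ {y} y∈β ηy with y ∈? core α
    ... | yes y∈α = contradiction y∈β (weak-split {α = α} {β} weak ηy y∈α)
    ... | no  _   = refl
  sound (_∨_ {α} {β} m n) Θ P Q η ρ δ cur δ-col weak (inj₁ h)
    with σ , col , ok ← sound m Θ P Q η ρ δ cur δ-col (weak-∨ˡ {β = β} weak) h =
    σ , col , inj₁ ∘ ok ∘ compatible-⊆ ∈-++⁺ˡ ∈-++⁺ˡ (λ _ _ → refl)
  sound (_∨_ {α} {β} m n) Θ P Q η ρ δ cur δ-col weak (inj₂ h)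
    with σ , col , ok ← sound n Θ P Q η ρ δ cur δ-col (weak-∨ʳ {α = α} weak) h =
    σ , col , inj₂ ∘ ok ∘ compatible-⊆ (∈-++⁺ʳ (free α)) (∈-++⁺ʳ (core α)) (λ _ _ → refl)
  -- No coloured variable is free in the universal formula, so the defaults δ can be returned. The
  -- witnesses inside depend on a and are found for each a separately.
  sound (forAll {d} {φ} d<F n) Θ P Q η ρ δ cur δ-col weak h = δ , δ-col , λ {σ′} → holds {σ′}
    where
    holds : ∀ {σ′} → Compatible Θ P Q (forAll d φ) η ρ δ σ′ → (a : Universe) → σ′ [ d ↦ a ] ⊨ φ
    holds {σ′} (compatible out _ _) a
      with Ξ , _ , P′ , Q′ , h′ ← to (⋁-sat (ρ [ d ↦ a ]) _ (schemes k)) (h a)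
      with σ , _ , ok ← sound n Ξ P′ Q′ ∅ (((ρ [ d ↦ a ]) [ p ↦ P′ ]) [ q ↦ Q′ ]) δ
             (current-parameters (ρ [ d ↦ a ])) (λ ()) (λ ()) h′ =
      ok (compatible (λ y∈ _ → trans (agree y∈) (sym (parameters-other (ρ [ d ↦ a ]) (free<F n y∈))))
                     (λ _ ()) (λ _ ()))
      where
      agree : ∀ {y} → y ∈ free φ → (σ′ [ d ↦ a ]) y ≡ (ρ [ d ↦ a ]) y
      agree {y} y∈ with y ≟ d
      ... | yes _   = refl
      ... | no  y≢d = out (∈-remove⁺ {τ} y≢d y∈) (weak-forAll {φ = φ} weak y∈ y≢d)
  sound (exists {x} {φ} x<F n) Θ P Q η ρ δ cur δ-col weak h with strong? x φ
  ... | yes _ with a , h′ ← h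
              with σ , col , ok ← sound n Θ P Q (η [ x ≔ nothing ]) (ρ [ x ↦ a ]) (δ [ x ↦ a ])
                     (current-update Θ P Q (<⇒≢reserved 0 x<F) (<⇒≢reserved 1 x<F) cur)
                     (coloured-update {Θ} {P} {Q} {η} {δ} {x} {nothing} {a} δ-col λ ()) (weak-exists weak λ ()) h′ =
    σ [ x ↦ δ x ] , unhide {Θ} {P} {Q} {η} {σ} {x} (δ x) col δ-col , λ compat →
      a , ok (compatible-binder (≔-other ρ) (λ _ → sym (≔-same ρ x)) (λ ()) compat)
  ... | no ¬strong with c , _ , (b , b-col) , h′ ← to (⋁-sat ρ _ (upTo (palette k Θ))) h
                   with σ , col , ok ← sound n Θ P Q (η [ x ≔ just c ]) ρ (δ [ x ↦ b ]) cur
                          (coloured-update {Θ} {P} {Q} {η} {δ} {x} {just c} {b} δ-col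
                            λ { refl → to (colour-w Θ P Q 0 cur c) b-col })
                          (weak-exists weak λ _ → ¬strong) h′ =
    σ [ x ↦ δ x ] , unhide {Θ} {P} {Q} {η} {σ} {x} (δ x) col δ-col , λ compat →
      σ x , ok (compatible-binder (λ _ → refl) (λ ()) (λ { refl → col (≔-same η x) , refl }) compat)

  -- Stops at universal quantifiers, below which a fresh colouring is chosen for each value of the
  -- bound variable.
  witnesses : ∀ {φ : Formula τ} (n : NNF F φ) {σ} → σ ⊨ φ → List Universe
  witnesses (literal _ _ _ _) _        = []
  witnesses (unequal _ _)     _        = []
  witnesses (m ∧ n)           (h , h′) = witnesses m h ++ witnesses n h′
  witnesses (m ∨ n)           (inj₁ h) = witnesses m h
  witnesses (m ∨ n)           (inj₂ h) = witnesses n h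
  witnesses (forAll _ n)      _        = []
  witnesses (exists _ n)      (a , h)  = a ∷ witnesses n h

  length-witnesses : ∀ {φ : Formula τ} (n : NNF F φ) {σ} (h : σ ⊨ φ) → length (witnesses n {σ} h) ≤ existentials n
  length-witnesses (literal _ _ _ _) _ = z≤n
  length-witnesses (unequal _ _)     _ = z≤n
  length-witnesses (m ∧ n) {σ} (h , h′) = ≤-trans
    (≤-reflexive (length-++ (witnesses m {σ} h))) (+-mono-≤ (length-witnesses m h) (length-witnesses n h′))
  length-witnesses (m ∨ n) (inj₁ h)    = m≤n⇒m≤n+o _ (length-witnesses m h)
  length-witnesses (m ∨ n) (inj₂ h)    = m≤n⇒m≤o+n _ (length-witnesses n h)
  length-witnesses (forAll _ n) _      = z≤n
  length-witnesses (exists _ n) (a , h) = s≤s (length-witnesses n h)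

  -- The values of the F names and the chosen witnesses are together at most k elements, so some
  -- scheme with suitable parameters separates them.
  perfect-witnesses : ∀ {φ : Formula τ} (n : NNF F φ) {σ} (h : σ ⊨ φ) → F + existentials n ≤ k →
    Σ[ Θ ∈ Scheme ] Θ ∈ schemes k × Σ[ P ∈ Universe ] Σ[ Q ∈ Universe ]
      Perfect Θ P Q (map σ (upTo F) ++ witnesses n {σ} h)
  perfect-witnesses n {σ} h size≤k = perfect (map σ (upTo F) ++ witnesses n {σ} h)
    (≤-trans (≤-reflexive (length-++ (map σ (upTo F))))
      (≤-trans (+-mono-≤ (≤-reflexive (trans (length-map σ (upTo F)) (length-upTo F))) (length-witnesses n h)) size≤k))

  -- The translation is satisfied by following the witnesses in h. Their values are in σ, whereas ρ
  -- agrees with σ on uncoloured variables only. W holds every value met before the next universal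
  -- quantifier, so perfection applies to each inequality on the way.
  complete : ∀ {φ : Formula τ} (n : NNF F φ) Θ P Q η ρ σ W → Current Θ P Q ρ → Perfect Θ P Q W → Weak η φ →
             F + existentials n ≤ k →
             (∀ {y} → y ∈ free φ → η y ≡ nothing → ρ y ≡ σ y) →
             (∀ {y c} → y ∈ free φ → η y ≡ just c → Colour Θ P Q (σ y) c) →
             (∀ {y} → y ∈ free φ → σ y ∈ W) →
             (h : σ ⊨ φ) → (∀ {a} → a ∈ witnesses n {σ} h → a ∈ W) →
             ρ ⊨ translate Θ η n

  -- The converse of soundness needs a perfect colouring: both values lie in W, so being distinct
  -- they cannot share a colour.
  apart-complete : ∀ {x y} → x < F → y < F → ∀ Θ P Q (η : Environment) ρ (σ : Assignment) W →
    Current Θ P Q ρ → Perfect Θ P Q W →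
    (∀ {z : Variable} → z ∈ x ∷ y ∷ [] → η z ≡ nothing → ρ z ≡ σ z) →
    (∀ {z : Variable} {c} → z ∈ x ∷ y ∷ [] → η z ≡ just c → Colour Θ P Q (σ z) c) →
    (∀ {z : Variable} → z ∈ x ∷ y ∷ [] → σ z ∈ W) →
    σ x ≢ σ y → ρ ⊨ apart Θ x y (η x) (η y)
  apart-complete {x} {y} x<F y<F Θ P Q η ρ σ W cur perf same col inW x≢y with η x in ηx | η y in ηy
  ... | nothing | nothing = λ eq → x≢y (trans (sym (same (here refl) ηx)) (trans eq (same (there (here refl)) ηy)))
  ... | just c  | nothing = λ y-c → x≢y (Perfect.distinct perf (inW (here refl)) (inW (there (here refl)))
        (col (here refl) ηx)
        (subst (λ a → Colour Θ P Q a c) (same (there (here refl)) ηy) (to (colour-at Θ P Q cur (fresh-< y<F) c) y-c)))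
  ... | nothing | just d  = λ x-d → x≢y (Perfect.distinct perf (inW (here refl)) (inW (there (here refl)))
        (subst (λ a → Colour Θ P Q a d) (same (here refl) ηx) (to (colour-at Θ P Q cur (fresh-< x<F) d) x-d))
        (col (there (here refl)) ηy))
  ... | just c  | just d with c ≟ d
  ...   | no  _    = refl
  ...   | yes refl = λ _ → x≢y (Perfect.distinct perf (inW (here refl)) (inW (there (here refl)))
        (col (here refl) ηx) (col (there (here refl)) ηy))

  complete {φ} (literal L fr _ _) Θ P Q η ρ σ W cur perf weak size≤k same col inW h wit =
    close-complete Θ P Q η {φ} L (free φ) 0 id cur (λ y∈ → <-≤-trans (fr y∈) (m≤m+n F 5)) h agree (λ {y} → col)
    where
    agree : ∀ {y} → y ∈ free φ → ρ y ≡ σ y ⊎ (y ∈ free φ × Σ[ c ∈ ℕ ] η y ≡ just c)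
    agree {y} y∈ with η y in ηy
    ... | nothing = inj₁ (same y∈ ηy)
    ... | just c  = inj₂ (y∈ , c , refl)
  complete (unequal x<F y<F) Θ P Q η ρ σ W cur perf weak size≤k same col inW h wit =
    apart-complete x<F y<F Θ P Q η ρ σ W cur perf same col inW h
  complete (_∧_ {α} {β} m n) Θ P Q η ρ σ W cur perf weak size≤k same col inW (h , h′) wit =
      complete m Θ P Q η ρ σ W cur perf (weak-∧ˡ {β = β} weak)
        (≤-trans (+-monoʳ-≤ F (m≤m+n _ _)) size≤k)
        (same ∘ ∈-++⁺ˡ) (col ∘ ∈-++⁺ˡ) (inW ∘ ∈-++⁺ˡ) h (wit ∘ ∈-++⁺ˡ)
    , complete n Θ P Q η ρ σ W cur perf (weak-∧ʳ {α = α} weak)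
        (≤-trans (+-monoʳ-≤ F (m≤n+m _ (existentials m))) size≤k)
        (same ∘ ∈-++⁺ʳ (free α)) (col ∘ ∈-++⁺ʳ (free α)) (inW ∘ ∈-++⁺ʳ (free α)) h′
        (wit ∘ ∈-++⁺ʳ (witnesses m {σ} h))
  complete (_∨_ {α} {β} m n) Θ P Q η ρ σ W cur perf weak size≤k same col inW (inj₁ h) wit = inj₁
    (complete m Θ P Q η ρ σ W cur perf (weak-∨ˡ {β = β} weak)
      (≤-trans (+-monoʳ-≤ F (m≤m+n _ _)) size≤k)
      (same ∘ ∈-++⁺ˡ) (col ∘ ∈-++⁺ˡ) (inW ∘ ∈-++⁺ˡ) h wit)
  complete (_∨_ {α} {β} m n) Θ P Q η ρ σ W cur perf weak size≤k same col inW (inj₂ h) wit = inj₂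
    (complete n Θ P Q η ρ σ W cur perf (weak-∨ʳ {α = α} weak)
      (≤-trans (+-monoʳ-≤ F (m≤n+m _ (existentials m))) size≤k)
      (same ∘ ∈-++⁺ʳ (free α)) (col ∘ ∈-++⁺ʳ (free α)) (inW ∘ ∈-++⁺ʳ (free α)) h wit)
  complete (forAll {d} {φ} d<F n) Θ P Q η ρ σ W cur perf weak size≤k same col inW h wit a
    with Ξ , Ξ∈ , P′ , Q′ , perf′ ← perfect-witnesses n {σ [ d ↦ a ]} (h a) size≤k =
    from (⋁-sat (ρ [ d ↦ a ]) _ (schemes k))
      ( Ξ , Ξ∈ , P′ , Q′
      , complete n Ξ P′ Q′ ∅ (((ρ [ d ↦ a ]) [ p ↦ P′ ]) [ q ↦ Q′ ]) (σ [ d ↦ a ]) _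
          (current-parameters (ρ [ d ↦ a ])) perf′ (λ ()) size≤k
          (λ y∈ _ → trans (parameters-other (ρ [ d ↦ a ]) (free<F n y∈)) (agree y∈)) (λ _ ())
          (λ y∈ → ∈-++⁺ˡ (∈-map⁺ (σ [ d ↦ a ]) (∈-upTo⁺ (free<F n y∈)))) (h a)
          (∈-++⁺ʳ (map (σ [ d ↦ a ]) (upTo F))) )
    where
    agree : ∀ {y} → y ∈ free φ → (ρ [ d ↦ a ]) y ≡ (σ [ d ↦ a ]) y
    agree {y} y∈ with y ≟ d
    ... | yes _   = refl
    ... | no  y≢d = same (∈-remove⁺ {τ} y≢d y∈) (weak-forAll {φ = φ} weak y∈ y≢d)
  complete (exists {x} {φ} x<F n) Θ P Q η ρ σ W cur perf weak size≤k same col inW (a , h) wit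
    with strong? x φ
  ... | yes _ = a , complete n Θ P Q (η [ x ≔ nothing ]) (ρ [ x ↦ a ]) (σ [ x ↦ a ]) W
      (current-update Θ P Q (<⇒≢reserved 0 x<F) (<⇒≢reserved 1 x<F) cur) perf (weak-exists weak λ ())
      (≤-trans (+-monoʳ-≤ F (n≤1+n _)) size≤k) same′ col′ inW′ h (wit ∘ there)
    where
    same′ : ∀ {y} → y ∈ free φ → (η [ x ≔ nothing ]) y ≡ nothing → (ρ [ x ↦ a ]) y ≡ (σ [ x ↦ a ]) y
    same′ {y} y∈ ηy with y ≟ x
    ... | yes _   = refl
    ... | no  y≢x = same (∈-remove⁺ {τ} y≢x y∈) ηy
    col′ : ∀ {y c} → y ∈ free φ → (η [ x ≔ nothing ]) y ≡ just c → Colour Θ P Q ((σ [ x ↦ a ]) y) c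
    col′ {y} y∈ ηy with y ≟ x
    ... | no  y≢x = col (∈-remove⁺ {τ} y≢x y∈) ηy
    inW′ : ∀ {y} → y ∈ free φ → (σ [ x ↦ a ]) y ∈ W
    inW′ {y} y∈ with y ≟ x
    ... | yes _   = wit (here refl)
    ... | no  y≢x = inW (∈-remove⁺ {τ} y≢x y∈)
  ... | no ¬strong with c , c< , a-c ← Perfect.coloured perf (wit (here refl)) =
    from (⋁-sat ρ _ (upTo (palette k Θ)))
      ( c , ∈-upTo⁺ c< , (a , from (colour-w Θ P Q 0 cur c) a-c)
      , complete n Θ P Q (η [ x ≔ just c ]) ρ (σ [ x ↦ a ]) W cur perf (weak-exists weak λ _ → ¬strong)
          (≤-trans (+-monoʳ-≤ F (n≤1+n _)) size≤k) same′ col′ inW′ h (wit ∘ there) )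
    where
    same′ : ∀ {y} → y ∈ free φ → (η [ x ≔ just c ]) y ≡ nothing → ρ y ≡ (σ [ x ↦ a ]) y
    same′ {y} y∈ ηy with y ≟ x
    ... | no  y≢x = same (∈-remove⁺ {τ} y≢x y∈) ηy
    col′ : ∀ {y d} → y ∈ free φ → (η [ x ≔ just c ]) y ≡ just d → Colour Θ P Q ((σ [ x ↦ a ]) y) d
    col′ {y} y∈ ηy with y ≟ x
    ... | yes _   = subst (Colour Θ P Q a) (just-injective ηy) a-c
    ... | no  y≢x = col (∈-remove⁺ {τ} y≢x y∈) ηy
    inW′ : ∀ {y} → y ∈ free φ → (σ [ x ↦ a ]) y ∈ W
    inW′ {y} y∈ with y ≟ x
    ... | yes _   = wit (here refl)
    ... | no  y≢x = inW (∈-remove⁺ {τ} y≢x y∈)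

  block-correct : ∀ {φ : Formula τ} (n : NNF F φ) → F + existentials n ≤ k → ∀ ρ → (ρ ⊨ block n) ⇔ (ρ ⊨ φ)
  block-correct {φ} n size≤k ρ = mk⇔ forwards backwards
    where
    forwards : ρ ⊨ block n → ρ ⊨ φ
    forwards h with Ξ , _ , P , Q , h′ ← to (⋁-sat ρ _ (schemes k)) h
               with σ , _ , ok ← sound n Ξ P Q ∅ ((ρ [ p ↦ P ]) [ q ↦ Q ]) ρ (current-parameters ρ) (λ ()) (λ ()) h′ =
      ok (compatible (λ y∈ _ → sym (parameters-other ρ (free<F n y∈))) (λ _ ()) (λ _ ()))
    backwards : ρ ⊨ φ → ρ ⊨ block n
    backwards h with Ξ , Ξ∈ , P , Q , perf ← perfect-witnesses n {ρ} h size≤k =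
      from (⋁-sat ρ _ (schemes k))
        ( Ξ , Ξ∈ , P , Q
        , complete n Ξ P Q ∅ ((ρ [ p ↦ P ]) [ q ↦ Q ]) ρ _ (current-parameters ρ) perf (λ ()) size≤k
            (λ y∈ _ → parameters-other ρ (free<F n y∈)) (λ _ ())
            (λ y∈ → ∈-++⁺ˡ (∈-map⁺ ρ (∈-upTo⁺ (free<F n y∈)))) h (∈-++⁺ʳ (map ρ (upTo F))) )

-- Quantifier rank and bound variables

unique-⊆⇒length≤ : ∀ {xs ys : List ℕ} → Unique xs → xs ⊆ ys → length xs ≤ length ys
unique-⊆⇒length≤ {[]}     _          _     = z≤n
unique-⊆⇒length≤ {x ∷ xs} {ys} (x∉xs ∷ unique) xs⊆ys = ≤-trans
  (s≤s (unique-⊆⇒length≤ {ys = filter other ys} unique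
    (λ y∈xs → ∈-filter⁺ other (xs⊆ys (there y∈xs)) (λ { refl → All¬⇒¬Any x∉xs y∈xs }))))
  (filter-notAll other ys (lose (xs⊆ys (here refl)) (λ x≢x → x≢x refl)))
  where other = λ y → ¬? (y ≟ x)

∣∣-mono : ∀ {xs ys} → xs ⊆ ys → ∣ xs ∣ ≤ ∣ ys ∣
∣∣-mono {xs} {ys} xs⊆ys = unique-⊆⇒length≤ (deduplicate-! _≟_ xs)
  (∈-deduplicate⁺ _≟_ ∘ xs⊆ys ∘ ∈-deduplicate⁻ _≟_ xs)

∣++∣≤ : ∀ {xs} ys zs → xs ⊆ ys ++ zs → ∣ xs ∣ ≤ ∣ ys ∣ + length zs
∣++∣≤ {xs} ys zs xs⊆ = ≤-trans
  (unique-⊆⇒length≤ (deduplicate-! _≟_ xs) (split ∘ ∈-++⁻ ys ∘ xs⊆ ∘ ∈-deduplicate⁻ _≟_ xs))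
  (≤-reflexive (length-++ (deduplicate _≟_ ys)))
  where
  split : ∀ {x} → x ∈ ys ⊎ x ∈ zs → x ∈ deduplicate _≟_ ys ++ zs
  split (inj₁ x∈) = ∈-++⁺ˡ (∈-deduplicate⁺ _≟_ x∈)
  split (inj₂ x∈) = ∈-++⁺ʳ (deduplicate _≟_ ys) x∈

module _ {τ : Signature} where

  length-termVars : (t : Term τ) → length (termVars t) ≤ 1
  length-termVars (var x)   = ≤-refl
  length-termVars (const c) = z≤n
  length-termVars (app f t) = length-termVars t

  length-vecVars : ∀ {n} (ts : Vec (Term τ) n) → length (vecVars ts) ≤ n
  length-vecVars []       = z≤n
  length-vecVars (t ∷ ts) = ≤-trans (≤-reflexive (length-++ (termVars t)))
    (+-mono-≤ (length-termVars t) (length-vecVars ts))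

  length-free-atom : ∀ {φ : Formula τ} → IsAtom φ → length (free φ) ≤ 2 ⊔ arity τ
  length-free-atom (rel R ts) = ≤-trans (length-vecVars ts)
    (≤-trans (All.lookup (xs≤max 0 (relations τ)) R) (m≤n⊔m 2 (arity τ)))
  length-free-atom (s ≐ t) = ≤-trans (≤-reflexive (length-++ (termVars s)))
    (≤-trans (+-mono-≤ (length-termVars s) (length-termVars t)) (m≤m⊔n 2 (arity τ)))

  module _ {F : ℕ} where

    atom-nnf : ∀ {φ : Formula τ} → IsAtom φ → (∀ {y} → y ∈ free φ → y < F) → NNF F φ
    atom-nnf A@(rel R ts) fr = literal (pos A) fr refl (length-free-atom A)
    atom-nnf A@(s ≐ t)    fr = literal (pos A) fr refl (length-free-atom A)

    -- The terms are split into cases because `core` reduces only once it is decided whether both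
    -- sides are variables.
    ~atom-nnf : ∀ {φ : Formula τ} → IsAtom φ → (∀ {y} → y ∈ free φ → y < F) → NNF F (~ φ)
    ~atom-nnf A@(rel R ts)            fr = literal (neg A) fr refl (length-free-atom A)
    ~atom-nnf A@(const c ≐ t)         fr = literal (neg A) fr refl (length-free-atom A)
    ~atom-nnf A@(app f s ≐ t)         fr = literal (neg A) fr refl (length-free-atom A)
    ~atom-nnf A@(var x ≐ const c)     fr = literal (neg A) fr refl (length-free-atom A)
    ~atom-nnf A@(var x ≐ app f t)     fr = literal (neg A) fr refl (length-free-atom A)
    ~atom-nnf (var x ≐ var y)         fr = unequal (fr (here refl)) (fr (there (here refl)))

    below-binder : ∀ {d} (φ : Formula τ) → d < F → (∀ {y} → y ∈ remove {τ} d (free φ) → y < F) →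
                   ∀ {y} → y ∈ free φ → y < F
    below-binder {d} φ d<F fr {y} y∈ with y ≟ d
    ... | yes refl = d<F
    ... | no  y≢d  = fr (∈-remove⁺ {τ} y≢d y∈)

    nnf : ∀ {φ : Formula τ} → IsNNF φ → (∀ {y} → y ∈ free φ → y < F) → (∀ {y} → y ∈ bound φ → y < F) →
          NNF F φ
    nnf (atom A)       fr bd = atom-nnf A fr
    nnf (~ A)          fr bd = ~atom-nnf A fr
    nnf (_∧_ {φ} m n)  fr bd = nnf m (fr ∘ ∈-++⁺ˡ) (bd ∘ ∈-++⁺ˡ)
                             ∧ nnf n (fr ∘ ∈-++⁺ʳ (free φ)) (bd ∘ ∈-++⁺ʳ (bound φ))
    nnf (_∨_ {φ} m n)  fr bd = nnf m (fr ∘ ∈-++⁺ˡ) (bd ∘ ∈-++⁺ˡ)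
                             ∨ nnf n (fr ∘ ∈-++⁺ʳ (free φ)) (bd ∘ ∈-++⁺ʳ (bound φ))
    nnf (forAll {φ} d n) fr bd =
      forAll (bd (here refl)) (nnf n (below-binder φ (bd (here refl)) fr) (bd ∘ there))
    nnf (exists {φ} x n) fr bd =
      exists (bd (here refl)) (nnf n (below-binder φ (bd (here refl)) fr) (bd ∘ there))

-- Cost of the translation, and padding to the exact values

module Bounds {τ : Signature} (ar : IsArithmetic τ) (F k : ℕ) .{{k≢0 : NonZero k}} where

  open Translation ar F k

  M : ℕ
  M = 2 ⊔ arity τ

  qr-rename : ∀ {φ : Formula τ} r (L : Literal φ) → qr (rename r L) ≡ 0
  qr-rename r (pos (rel R ts)) = refl
  qr-rename r (pos (s ≐ t))    = refl
  qr-rename r (neg (rel R ts)) = refl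
  qr-rename r (neg (s ≐ t))    = refl

  qr-basic : ∀ Θ v c → qr (basic Θ v c) ≤ 3
  qr-basic byNumeral     v c = z≤n
  qr-basic (byResidue a) v c = ≤-refl

  qr-none-below : ∀ Θ v c → qr (none-below Θ v c) ≤ 3
  qr-none-below Θ v zero    = z≤n
  qr-none-below Θ v (suc c) = ⊔-lub (qr-none-below Θ v c) (qr-basic Θ v c)

  qr-colour : ∀ Θ v c → qr (colour Θ v c) ≤ 3
  qr-colour Θ v c = ⊔-lub (qr-none-below Θ v c) (qr-basic Θ v c)

  qr-close : ∀ Θ η {φ : Formula τ} (L : Literal φ) i r xs → qr (close Θ η L i r xs) ≤ length xs + 3
  qr-close Θ η L i r []       = ≤-trans (≤-reflexive (qr-rename r L)) z≤n
  qr-close Θ η L i r (x ∷ xs) with η x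
  ... | nothing = m≤n⇒m≤1+n (qr-close Θ η L i r xs)
  ... | just c  = s≤s (⊔-lub (≤-trans (qr-colour Θ (w i) c) (m≤n+m 3 (length xs)))
                             (qr-close Θ η L (suc i) _ xs))

  qr-apart : ∀ Θ x y c d → qr (apart Θ x y c d) ≤ 3
  qr-apart Θ x y (just c) (just d) with c ≟ d
  ... | yes _ = z≤n
  ... | no  _ = z≤n
  qr-apart Θ x y (just c) nothing  = qr-colour Θ y c
  qr-apart Θ x y nothing  (just d) = qr-colour Θ x d
  qr-apart Θ x y nothing  nothing  = z≤n

  qr-⋁ : ∀ {A : Set} {b} (f : A → Formula τ) xs → (∀ x → qr (f x) ≤ b) → qr (⋁ (map f xs)) ≤ b
  qr-⋁ f []       f≤ = z≤n
  qr-⋁ f (x ∷ xs) f≤ = ⊔-lub (f≤ x) (qr-⋁ f xs f≤)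

  -- A universal quantifier costs three: itself and the new p and q. A strong existential costs one
  -- of the three allotted to it. A weak one adds nothing to the nesting, since its test for an
  -- inhabited colour, of rank at most 1 + 3, stands beside the rest; the summand M + 4 covers this
  -- test as well as the closing of a literal.
  qr-translate : ∀ {φ} Θ η (n : NNF F φ) → qr (translate Θ η n) ≤ 3 * strong-qr φ + (M + 4)
  qr-translate {φ} Θ η (literal L _ _ free≤M) = ≤-trans (qr-close Θ η L 0 id (free φ))
    (≤-trans (+-mono-≤ free≤M (n≤1+n 3)) (m≤n+m (M + 4) (3 * strong-qr φ)))
  qr-translate Θ η (unequal {x} {y} _ _) = ≤-trans (qr-apart Θ x y (η x) (η y)) (≤-trans (n≤1+n 3) (m≤n+m 4 M))
  qr-translate Θ η (_∧_ {φ} {ψ} m n) = ⊔-lub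
    (≤-trans (qr-translate Θ η m) (+-monoˡ-≤ (M + 4) (*-monoʳ-≤ 3 (m≤m⊔n (strong-qr φ) (strong-qr ψ)))))
    (≤-trans (qr-translate Θ η n) (+-monoˡ-≤ (M + 4) (*-monoʳ-≤ 3 (m≤n⊔m (strong-qr φ) (strong-qr ψ)))))
  qr-translate Θ η (_∨_ {φ} {ψ} m n) = ⊔-lub
    (≤-trans (qr-translate Θ η m) (+-monoˡ-≤ (M + 4) (*-monoʳ-≤ 3 (m≤m⊔n (strong-qr φ) (strong-qr ψ)))))
    (≤-trans (qr-translate Θ η n) (+-monoˡ-≤ (M + 4) (*-monoʳ-≤ 3 (m≤n⊔m (strong-qr φ) (strong-qr ψ)))))
  qr-translate Θ η (forAll {d} {φ} _ n) = ≤-trans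
    (s≤s (qr-⋁ _ (schemes k) (λ Ξ → s≤s (s≤s (qr-translate Ξ ∅ n)))))
    (≤-reflexive (cong (_+ (M + 4)) (sym (*-suc 3 (strong-qr φ)))))
  qr-translate Θ η (exists {x} {φ} _ n) with strong? x φ
  ... | yes _ = ≤-trans (s≤s (qr-translate Θ _ n))
    (+-monoˡ-≤ (M + 4) (≤-trans (+-monoˡ-≤ _ (s≤s (z≤n {2}))) (≤-reflexive (sym (*-suc 3 (strong-qr φ))))))
  ... | no _  = qr-⋁ _ (upTo (palette k Θ)) (λ c → ⊔-lub
    (≤-trans (s≤s (qr-colour Θ (w 0) c)) (≤-trans (m≤n+m 4 M) (m≤n+m (M + 4) (3 * strong-qr φ))))
    (qr-translate Θ _ n))

  qr-block : ∀ {φ} (n : NNF F φ) → qr (block n) ≤ 3 * strong-qr φ + (M + 6)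
  qr-block {φ} n = ≤-trans (qr-⋁ _ (schemes k) (λ Ξ → s≤s (s≤s (qr-translate Ξ ∅ n))))
    (≤-reflexive (shift (3 * strong-qr φ) M))
    where
    shift : ∀ a m → 2 + (a + (m + 4)) ≡ a + (m + 6)
    shift = solve-∀

  -- Five fixed auxiliary names, and one `w i` for each of the at most M variable occurrences in a
  -- literal. Every block uses the same ones.
  Reserved : Variable → Set
  Reserved y = Σ[ j ∈ ℕ ] j < 5 + M × y ≡ F + j

  reserved : ∀ j → j < 5 → Reserved (F + j)
  reserved j j<5 = j , <-≤-trans j<5 (m≤m+n 5 M) , refl

  bound-rename : ∀ {φ : Formula τ} r (L : Literal φ) {y} → y ∉ bound (rename r L)
  bound-rename r (pos (rel R ts)) ()
  bound-rename r (pos (s ≐ t))    ()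
  bound-rename r (neg (rel R ts)) ()
  bound-rename r (neg (s ≐ t))    ()

  bound-basic : ∀ Θ v c {y} → y ∈ bound (basic Θ v c) → Reserved y
  bound-basic (byResidue a) v c (here refl)                 = reserved 2 (s≤s (s≤s (s≤s z≤n)))
  bound-basic (byResidue a) v c (there (here refl))         = reserved 3 (s≤s (s≤s (s≤s (s≤s z≤n))))
  bound-basic (byResidue a) v c (there (there (here refl))) = reserved 4 ≤-refl

  bound-none-below : ∀ Θ v c {y} → y ∈ bound (none-below Θ v c) → Reserved y
  bound-none-below Θ v (suc c) y∈ with ∈-++⁻ (bound (none-below Θ v c)) y∈
  ... | inj₁ y∈ˡ = bound-none-below Θ v c y∈ˡ
  ... | inj₂ y∈ʳ = bound-basic Θ v c y∈ʳ

  bound-colour : ∀ Θ v c {y} → y ∈ bound (colour Θ v c) → Reserved y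
  bound-colour Θ v c y∈ with ∈-++⁻ (bound (none-below Θ v c)) y∈
  ... | inj₁ y∈ˡ = bound-none-below Θ v c y∈ˡ
  ... | inj₂ y∈ʳ = bound-basic Θ v c y∈ʳ

  bound-close : ∀ Θ η {φ : Formula τ} (L : Literal φ) i r xs → i + length xs ≤ M →
                ∀ {y} → y ∈ bound (close Θ η L i r xs) → Reserved y
  bound-close Θ η L i r []       i≤ y∈ = contradiction y∈ (bound-rename r L)
  bound-close Θ η L i r (x ∷ xs) i≤ y∈ with η x
  ... | nothing = bound-close Θ η L i r xs (≤-trans (+-monoʳ-≤ i (n≤1+n _)) i≤) y∈
  bound-close Θ η L i r (x ∷ xs) i≤ (here refl) | just c =
    5 + i , +-monoʳ-< 5 (<-≤-trans (m<m+n i (s≤s z≤n)) i≤) , refl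
  bound-close Θ η L i r (x ∷ xs) i≤ (there y∈) | just c with ∈-++⁻ (bound (colour Θ (w i) c)) y∈
  ... | inj₁ y∈ˡ = bound-colour Θ (w i) c y∈ˡ
  ... | inj₂ y∈ʳ = bound-close Θ η L (suc i) _ xs (≤-trans (≤-reflexive (sym (+-suc i (length xs)))) i≤) y∈ʳ

  bound-apart : ∀ Θ x y c d {z} → z ∈ bound (apart Θ x y c d) → Reserved z
  bound-apart Θ x y (just c) (just d) z∈ with c ≟ d
  bound-apart Θ x y (just c) (just d) () | yes _
  bound-apart Θ x y (just c) (just d) () | no _
  bound-apart Θ x y (just c) nothing  z∈ = bound-colour Θ y c z∈
  bound-apart Θ x y nothing  (just d) z∈ = bound-colour Θ x d z∈

  bound-⋁ : ∀ {A : Set} {P : Variable → Set} (f : A → Formula τ) xs →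
            (∀ x {y} → y ∈ bound (f x) → P y) → ∀ {y} → y ∈ bound (⋁ (map f xs)) → P y
  bound-⋁ f (x ∷ xs) f⊆ y∈ with ∈-++⁻ (bound (f x)) y∈
  ... | inj₁ y∈ˡ = f⊆ x y∈ˡ
  ... | inj₂ y∈ʳ = bound-⋁ f xs f⊆ y∈ʳ

  Bound : Formula τ → Variable → Set
  Bound φ y = y ∈ strong-bound φ ⊎ Reserved y

  bound-translate : ∀ {φ} Θ η (n : NNF F φ) {y} → y ∈ bound (translate Θ η n) → Bound φ y

  bound-block : ∀ {φ} (n : NNF F φ) {y} → y ∈ bound (block n) → Bound φ y

  bound-parameters : ∀ {φ} (n : NNF F φ) Ξ {y} → y ∈ bound (exists p (exists q (translate Ξ ∅ n))) → Bound φ y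
  bound-parameters n Ξ (here refl)         = inj₂ (reserved 0 (s≤s z≤n))
  bound-parameters n Ξ (there (here refl)) = inj₂ (reserved 1 (s≤s (s≤s z≤n)))
  bound-parameters n Ξ (there (there y∈))  = bound-translate Ξ ∅ n y∈

  bound-block n = bound-⋁ (λ Ξ → exists p (exists q (translate Ξ ∅ n))) (schemes k) (bound-parameters n)

  bound-translate {φ} Θ η (literal L _ _ free≤M) y∈ = inj₂ (bound-close Θ η L 0 id (free φ) free≤M y∈)
  bound-translate Θ η (unequal {x} {y} _ _) z∈ = inj₂ (bound-apart Θ x y (η x) (η y) z∈)
  bound-translate Θ η (_∧_ {φ} m n) y∈ with ∈-++⁻ (bound (translate Θ η m)) y∈
  ... | inj₁ y∈ˡ = Sum.map₁ ∈-++⁺ˡ (bound-translate Θ η m y∈ˡ)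
  ... | inj₂ y∈ʳ = Sum.map₁ (∈-++⁺ʳ (strong-bound φ)) (bound-translate Θ η n y∈ʳ)
  bound-translate Θ η (_∨_ {φ} m n) y∈ with ∈-++⁻ (bound (translate Θ η m)) y∈
  ... | inj₁ y∈ˡ = Sum.map₁ ∈-++⁺ˡ (bound-translate Θ η m y∈ˡ)
  ... | inj₂ y∈ʳ = Sum.map₁ (∈-++⁺ʳ (strong-bound φ)) (bound-translate Θ η n y∈ʳ)
  bound-translate Θ η (forAll _ n) (here refl) = inj₁ (here refl)
  bound-translate Θ η (forAll _ n) (there y∈)  = Sum.map₁ there (bound-block n y∈)
  bound-translate Θ η (exists {x} {φ} _ n) y∈ with strong? x φ
  bound-translate Θ η (exists {x} {φ} _ n) (here refl) | yes _ = inj₁ (here refl)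
  bound-translate Θ η (exists {x} {φ} _ n) (there y∈)  | yes _ = Sum.map₁ there (bound-translate Θ _ n y∈)
  ... | no _ = bound-⋁ {P = Bound φ} (λ c → exists (w 0) (colour Θ (w 0) c) ∧ translate Θ (η [ x ≔ just c ]) n)
                      (upTo (palette k Θ)) each y∈
    where
    each : ∀ c {y} → y ∈ bound (exists (w 0) (colour Θ (w 0) c) ∧ translate Θ (η [ x ≔ just c ]) n) → Bound φ y
    each c (here refl) = inj₂ (5 , +-monoʳ-< 5 (≤-trans (s≤s z≤n) (m≤m⊔n 2 (arity τ))) , refl)
    each c (there y∈) with ∈-++⁻ (bound (colour Θ (w 0) c)) y∈
    ... | inj₁ y∈ˡ = inj₂ (bound-colour Θ (w 0) c y∈ˡ)
    ... | inj₂ y∈ʳ = bound-translate Θ _ n y∈ʳ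

  -- Requantifying the single name `p` raises the quantifier rank without adding bound names.
  nest : ℕ → Formula τ
  nest zero    = ⊤′
  nest (suc m) = exists p (nest m)

  touch : List Variable → Formula τ
  touch []       = ⊤′
  touch (x ∷ xs) = exists x ⊤′ ∧ touch xs

  qr-nest : ∀ m → qr (nest m) ≡ m
  qr-nest zero    = refl
  qr-nest (suc m) = cong suc (qr-nest m)

  qr-touch : ∀ xs → qr (touch xs) ≤ 1
  qr-touch []       = z≤n
  qr-touch (x ∷ xs) = ⊔-lub ≤-refl (qr-touch xs)

  bound-nest : ∀ m {y} → y ∈ bound (nest m) → Reserved y
  bound-nest (suc m) (here refl) = reserved 0 (s≤s z≤n)
  bound-nest (suc m) (there y∈)  = bound-nest m y∈

  bound-touch : ∀ xs → bound (touch xs) ≡ xs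
  bound-touch []       = refl
  bound-touch (x ∷ xs) = cong (x ∷_) (bound-touch xs)

  rankBound : Formula τ → ℕ
  rankBound φ = 3 * strong-qr φ + (M + 6)

  -- The two added conjuncts are valid; they raise the quantifier rank to the bound
  -- and make every strongly bound variable occur bound.
  padded : ∀ {φ} → NNF F φ → Formula τ
  padded {φ} n = block n ∧ nest (rankBound φ) ∧ touch (strong-bound φ)

  qr-padded : ∀ {φ} (n : NNF F φ) → qr (padded n) ≡ rankBound φ
  qr-padded {φ} n = trans (m≤n⇒m⊔n≡n (≤-trans (qr-block n) (≤-reflexive (sym rest)))) rest
    where
    rest : qr (nest (rankBound φ)) ⊔ qr (touch (strong-bound φ)) ≡ rankBound φ
    rest = trans (cong (_⊔ qr (touch (strong-bound φ))) (qr-nest (rankBound φ)))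
      (m≥n⇒m⊔n≡m (≤-trans (qr-touch (strong-bound φ))
        (≤-trans (s≤s z≤n) (≤-trans (m≤n+m 6 M) (m≤n+m (M + 6) (3 * strong-qr φ))))))

  strong-bound⊆ : ∀ {φ} (n : NNF F φ) → strong-bound φ ⊆ bound (padded n)
  strong-bound⊆ {φ} n y∈ = ∈-++⁺ʳ (bound (block n)) (∈-++⁺ʳ (bound (nest (rankBound φ)))
    (subst (_ ∈_) (sym (bound-touch (strong-bound φ))) y∈))

  bound-padded⊆ : ∀ {φ} (n : NNF F φ) → bound (padded n) ⊆ strong-bound φ ++ map (F +_) (upTo (5 + M))
  bound-padded⊆ {φ} n y∈ with ∈-++⁻ (bound (block n)) y∈
  ... | inj₁ y∈ˡ = list (bound-block n y∈ˡ)
    where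
    list : ∀ {y} → Bound φ y → y ∈ strong-bound φ ++ map (F +_) (upTo (5 + M))
    list (inj₁ y∈) = ∈-++⁺ˡ y∈
    list (inj₂ (j , j< , refl)) = ∈-++⁺ʳ (strong-bound φ) (∈-map⁺ (F +_) (∈-upTo⁺ j<))
  ... | inj₂ y∈ʳ with ∈-++⁻ (bound (nest (rankBound φ))) y∈ʳ
  ...   | inj₁ y∈ˡ with j , j< , refl ← bound-nest (rankBound φ) y∈ˡ =
    ∈-++⁺ʳ (strong-bound φ) (∈-map⁺ (F +_) (∈-upTo⁺ j<))
  ...   | inj₂ y∈ʳʳ = ∈-++⁺ˡ (subst (_ ∈_) (bound-touch (strong-bound φ)) y∈ʳʳ)

  ∣bound-padded∣≤ : ∀ {φ} (n : NNF F φ) → ∣ bound (padded n) ∣ ≤ ∣ strong-bound φ ∣ + (5 + M)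
  ∣bound-padded∣≤ {φ} n = ≤-trans (∣++∣≤ (strong-bound φ) _ (bound-padded⊆ n))
    (≤-reflexive (cong (∣ strong-bound φ ∣ +_) (trans (length-map (F +_) (upTo (5 + M))) (length-upTo (5 + M)))))

  module _ (S : Structure τ) where
    open Structure S
    open Semantics S

    nest-holds : ∀ m ρ → ρ ⊨ nest m
    nest-holds zero    ρ = refl
    nest-holds (suc m) ρ = ⟦ IsArithmetic.zero ar ⟧ᶜ , nest-holds m _

    touch-holds : ∀ xs ρ → ρ ⊨ touch xs
    touch-holds []       ρ = refl
    touch-holds (x ∷ xs) ρ = (⟦ IsArithmetic.zero ar ⟧ᶜ , refl) , touch-holds xs ρ

  padded-equivalent : ∀ {φ} (n : NNF F φ) → F + existentials n ≤ k → Equivalent ar (padded n) φ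
  padded-equivalent {φ} n size≤k S S-arith ρ = mk⇔
    (to (Correctness.block-correct ar F k S S-arith n size≤k ρ) ∘ proj₁)
    (λ h → from (Correctness.block-correct ar F k S S-arith n size≤k ρ) h
         , nest-holds S (rankBound φ) ρ , touch-holds S (strong-bound φ) ρ)

theorem3p5 : Σ[ c ∈ ℕ ]
    ((τ : Signature) (ar : IsArithmetic τ) (φ : Formula τ) → IsNNF φ →
    Σ[ φ' ∈ Formula τ ]
    ( Equivalent ar φ' φ
    × (Σ[ a ∈ ℕ ] (a ≤ c * arity τ + c × qr φ' ≡ 3 * strong-qr φ + a))
    × (Σ[ b ∈ ℕ ] (b ≤ c * arity τ + c × ∣ bound φ' ∣ ≡ ∣ strong-bound φ ∣ + b)) ))
-- The additive costs are at most max(2, r) + 6 ≤ r + 8 for r = `arity τ`.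
theorem3p5 = 8 , λ τ ar φ φ-nnf →
  let
    names     = free φ ++ bound φ
    F         = suc (max 0 names)
    below-F   = λ {y} (y∈ : y ∈ names) → s≤s (All.lookup (xs≤max 0 names) y∈)
    n         = nnf {F = F} φ-nnf (below-F ∘ ∈-++⁺ˡ) (below-F ∘ ∈-++⁺ʳ (free φ))
    -- One colour for each name and for each existential witness; F is a successor, so k is nonzero.
    k         = F + existentials n
    φ'        = Bounds.padded ar F k n
    sb≤bound  = ∣∣-mono (Bounds.strong-bound⊆ ar F k n)
  in
    φ'
  , Bounds.padded-equivalent ar F k n ≤-refl
  , ( (2 ⊔ arity τ) + 6
    , linear (arity τ) 6 ≤-refl
    , Bounds.qr-padded ar F k n )
  -- Truncated subtraction is exact here, because the padding makes every strongly bound name occur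
  -- bound.
  , ( ∣ bound φ' ∣ ∸ ∣ strong-bound φ ∣
    , ≤-trans (m≤n+o⇒m∸n≤o ∣ bound φ' ∣ ∣ strong-bound φ ∣ (Bounds.∣bound-padded∣≤ ar F k n))
        (≤-trans (≤-reflexive (+-comm 5 (2 ⊔ arity τ))) (linear (arity τ) 5 (n≤1+n 5)))
    , sym (m+[n∸m]≡n sb≤bound) )
  where
  linear : ∀ r j → j ≤ 6 → (2 ⊔ r) + j ≤ 8 * r + 8
  linear r j j≤6 = ≤-trans (+-mono-≤ (m⊔n≤m+n 2 r) j≤6)
    (≤-trans (≤-reflexive (trans (+-assoc 2 r 6) (trans (+-comm 2 (r + 6)) (+-assoc r 6 2))))
             (+-monoˡ-≤ 8 (m≤n*m r 8)))
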